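{- Let $e\ge2$ be an integer and $p^r$ a prime power with $p^r\equiv1\pmod e$. Fix a generator $\gamma$ of $\mathbb{F}_{p^r}^\times$, let $\chi$ be the character of order $e$ on $\mathbb{F}_{p^r}$ with $\chi(\gamma)=\zeta_e$, $\chi(0)=0$, and for an integer $n\ge1$ let $\chi'=\chi\circ\mathrm{Nr}$ be its lift to $\mathbb{F}_{p^{nr}}$, where $\mathrm{Nr}:\mathbb{F}_{p^{nr}}\to\mathbb{F}_{p^r}$ is the norm. Let $C_{p^r}$ be the multiplication matrix of the Gaussian periods of degree $e$ for $\mathbb{F}_{p^r}$, and $C_{p^{nr}}$ that for $\mathbb{F}_{p^{nr}}$. Then for any integer $n\ge1$ the following are equivalent: (1) $J^*_{p^{nr}}((\chi')^a,(\chi')^b)=(-1)^{n-1}J^*_{p^r}(a,b)^n$ for all $a,b\in\mathbb{Z}$ with $e\nmid a$, $e\nmid b$, $e\nmid a+b$; (2) $C_{p^{nr}}=(-1)^{n-1}C_{p^r}^{(n)}$, where $C_{p^r}^{(n)}=C_{p^r}\overset{ -1}{\ast}\cdots\overset{ -1}{\ast}C_{p^r}$ ($n$-fold).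
   Context: $\zeta_n=e^{2\pi i/n}$. For a prime power $Q=p^m\equiv1\pmod e$, write $Q=eF+1$; given a generator $g$ of $\mathbb{F}_Q^\times$ and a multiplicative character $\psi$ of order $e$ with $\psi(g)=\zeta_e$, the Gaussian periods are $\eta_Q(i)=\sum_{j=0}^{F-1}\zeta_p^{\mathrm{Tr}(g^{ej+i})}$ ($0\le i\le e-1$, $\mathrm{Tr}:\mathbb{F}_Q\to\mathbb{F}_p$), the cyclotomic numbers are $\mathrm{Cyc}_Q(i,j)=\#\{(v_1,v_2):0\le v_1,v_2\le F-1,\ 1+g^{ev_1+i}=g^{ev_2+j}\}$, and the multiplication matrix of the Gaussian periods is $C_Q=[\mathrm{Cyc}_Q(i,j)-D_iF]_{0\le i,j\le e-1}$, where $D_i=\delta_{0,i}$ if $F$ is even or $p=2$, and $D_i=\delta_{e/2,i}$ if $F$ is odd and $p\ne2$; it satisfies $\eta_Q(m)\eta_Q(m+i)=\sum_j C_Q[i,j]\eta_Q(m+j)$. Jacobi sums: $J^*_Q(\psi_1,\psi_2)=\sum_{\alpha\ne0,1}\psi_1(\alpha)\psi_2(1-\alpha)$, and $J^*_{p^r}(a,b):=J^*_{p^r}(\chi^a,\chi^b)$. For $\mathbb{F}_{p^{nr}}$ these objects are taken with respect to a generator $\gamma'$ of $\mathbb{F}_{p^{nr}}^\times$ with $\chi'(\gamma')=\zeta_e$. The $(-1)$-composition of $e\times e$ matrices (indices mod $e$) is $(A\overset{ -1}{\ast}B)[i,j]=\sum_{s,t=0}^{e-1}a_{s,t}b_{ -s+i,-t+j}$;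 it is associative and commutative. -}

module Defs where

open import Level using (0ℓ)
open import Data.Nat as ℕ using (ℕ; zero; suc; _∸_; NonZero)
open import Data.Nat.DivMod using (_/_; _%_; _mod_)
open import Data.Integer as ℤ using (ℤ; +_; _%ℕ_)
open import Data.Integer.Divisibility as ℤD using ()
open import Data.Fin as Fin using (Fin; toℕ)
open import Data.List as List using (List; foldr; allFin; upTo; map)
open import Data.Nat.ListAction using (sum)
open import Data.Bool using (Bool; true; false; if_then_else_; _∨_)
open import Data.Product using (∃; _×_; _,_)
open import Data.Sum using (_⊎_)
open import Relation.Nullary using (¬_; does)
open import Relation.Nullary.Decidable using (⌊_⌋)
open import Relation.Binary.PropositionalEquality using (_≡_; _≢_)
open import Algebra.Structures using (IsCommutativeRing)
open import Algebra.Bundles using (CommutativeRing)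
open import Function.Bundles using (_⇔_)

-- A finite field of order q, presented (up to isomorphism) on the
-- carrier Fin q, with propositional equality.

record FiniteFieldOn (q : ℕ) : Set where
  infixl 6 _⊕_
  infixl 7 _⊗_
  field
    _⊕_ _⊗_           : Fin q → Fin q → Fin q
    ⊖_                : Fin q → Fin q
    𝟘 𝟙               : Fin q
    isCommutativeRing : IsCommutativeRing _≡_ _⊕_ _⊗_ ⊖_ 𝟘 𝟙
    𝟘≢𝟙               : 𝟘 ≢ 𝟙
    inverse           : ∀ x → x ≢ 𝟘 → ∃ λ y → x ⊗ y ≡ 𝟙

  _^_ : Fin q → ℕ → Fin q
  x ^ zero  = 𝟙
  x ^ suc k = x ⊗ (x ^ k)

  IsGenerator : Fin q → Set
  IsGenerator g = g ≢ 𝟘 × (∀ α → α ≢ 𝟘 → ∃ λ k → g ^ k ≡ α)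

  -- discrete logarithm: least k < q with g ^ k ≡ α (junk value if none)
  dlog : Fin q → Fin q → ℕ
  dlog g α = go q 0
    where
    go : ℕ → ℕ → ℕ
    go zero    k = k
    go (suc m) k = if ⌊ g ^ k Fin.≟ α ⌋ then k else go m (suc k)

  isZero : Fin q → Bool
  isZero α = ⌊ α Fin.≟ 𝟘 ⌋

open FiniteFieldOn public using (IsGenerator)

record IsFieldEmbedding {q q′ : ℕ} (F : FiniteFieldOn q) (K : FiniteFieldOn q′)
                        (ι : Fin q → Fin q′) : Set where
  private
    module F = FiniteFieldOn F
    module K = FiniteFieldOn K
  field
    pres-⊕ : ∀ x y → ι (x F.⊕ y) ≡ ι x K.⊕ ι y
    pres-⊗ : ∀ x y → ι (x F.⊗ y) ≡ ι x K.⊗ ι y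
    pres-𝟙 : ι F.𝟙 ≡ K.𝟙

normExp : ℕ → ℕ → ℕ
normExp Q n = sum (map (λ i → Q ℕ.^ i) (upTo n))

-- The coefficient ring for character values: a commutative ring R
-- which is an integral domain of characteristic 0 containing a
-- primitive e-th root of unity ζ (e.g. ℂ with ζ = ζ_e).

module _ (R : CommutativeRing 0ℓ 0ℓ) where
  open CommutativeRing R

  powR : Carrier → ℕ → Carrier
  powR x zero    = 1#
  powR x (suc k) = x * powR x k

  natR : ℕ → Carrier
  natR zero    = 0#
  natR (suc m) = 1# + natR m

  IsCharZeroDomain : Set
  IsCharZeroDomain =
    (∀ x y → x * y ≈ 0# → x ≈ 0# ⊎ y ≈ 0#) × (∀ m → natR m ≈ 0# → m ≡ 0)

  IsPrimitiveRoot : ℕ → Carrier → Set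
  IsPrimitiveRoot e ζ =
    powR ζ e ≈ 1# × (∀ k → 0 ℕ.< k → k ℕ.< e → ¬ (powR ζ k ≈ 1#))

  sumR : {q : ℕ} → (Fin q → Carrier) → Carrier
  sumR {q} f = foldr (λ α s → f α + s) 0# (allFin q)

  chiPow : {q : ℕ} (F : FiniteFieldOn q) (g : Fin q) (e : ℕ) .{{_ : NonZero e}}
           (ζ : Carrier) (a : ℤ) → Fin q → Carrier
  chiPow F g e ζ a α =
    if isZero α then 0# else powR ζ ((a ℤ.* + dlog g α) %ℕ e)
    where open FiniteFieldOn F

  jacobi : {q : ℕ} (F : FiniteFieldOn q) (ψ₁ ψ₂ : Fin q → Carrier) → Carrier
  jacobi F ψ₁ ψ₂ =
    sumR (λ α → if ⌊ α Fin.≟ 𝟘 ⌋ ∨ ⌊ α Fin.≟ 𝟙 ⌋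
                  then 0#
                  else ψ₁ α * ψ₂ (𝟙 ⊕ (⊖ α)))
    where open FiniteFieldOn F

Matrix : ℕ → Set
Matrix e = Fin e → Fin e → ℤ

sumℤ : {e : ℕ} → (Fin e → ℤ) → ℤ
sumℤ {e} f = foldr (λ s acc → f s ℤ.+ acc) (+ 0) (allFin e)

cyc : {Q : ℕ} (F : FiniteFieldOn Q) (g : Fin Q) (e : ℕ) .{{_ : NonZero e}} →
      Fin e → Fin e → ℕ
cyc {Q} F g e i j =
  sum (map (λ v₁ → sum (map (λ v₂ →
      if ⌊ (𝟙 ⊕ (g ^ (e ℕ.* v₁ ℕ.+ toℕ i))) Fin.≟ (g ^ (e ℕ.* v₂ ℕ.+ toℕ j)) ⌋
        then 1 else 0) (upTo f))) (upTo f))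
  where
  open FiniteFieldOn F
  f = (Q ∸ 1) / e

Dδ : (p Q e : ℕ) .{{_ : NonZero e}} → Fin e → ℕ
Dδ p Q e i =
  if ⌊ f % 2 ℕ.≟ 0 ⌋ ∨ ⌊ p ℕ.≟ 2 ⌋
    then (if ⌊ toℕ i ℕ.≟ 0 ⌋ then 1 else 0)
    else (if ⌊ toℕ i ℕ.≟ e / 2 ⌋ then 1 else 0)
  where f = (Q ∸ 1) / e

-- C_Q[i,j] = Cyc_Q(i,j) - D_i f   (p = characteristic of the field of order Q)
multMatrix : (p : ℕ) {Q : ℕ} (F : FiniteFieldOn Q) (g : Fin Q)
             (e : ℕ) .{{_ : NonZero e}} → Matrix e
multMatrix p {Q} F g e i j =
  + cyc F g e i j ℤ.- + (Dδ p Q e i ℕ.* ((Q ∸ 1) / e))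

subMod : (e : ℕ) .{{_ : NonZero e}} → Fin e → Fin e → Fin e
subMod e i s = (toℕ i ℕ.+ (e ∸ toℕ s)) mod e

compose : (e : ℕ) .{{_ : NonZero e}} → Matrix e → Matrix e → Matrix e
compose e A B i j =
  sumℤ (λ s → sumℤ (λ t → A s t ℤ.* B (subMod e i s) (subMod e j t)))

-- foldCompose e A k = A ∗ A ∗ ... ∗ A  ((k+1)-fold), so C^(n) = foldCompose e C (n ∸ 1)
foldCompose : (e : ℕ) .{{_ : NonZero e}} → Matrix e → ℕ → Matrix e
foldCompose e A zero    = A
foldCompose e A (suc k) = compose e A (foldCompose e A k)

{-# OPTIONS --safe #-}

-- The two-dimensional discrete Fourier transform on ℤ/e turns the (−1)-composition, which is a
-- convolution, into a product, and it is injective on integer matrices because R is a domain of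
-- characteristic zero containing a primitive e-th root of unity.  Summing over the discrete
-- logarithms in the definition of the cyclotomic numbers, the transform of C_Q at (a, b) is −1 if
-- e ∣ a, −ψᵃ(−1) Q if e ∣ b and e ∤ a, −1 if e ∣ a + b and e ∤ b, and ψᵃ(−1) J(ψᵃ, ψᵇ) whenever
-- e ∤ b.  The norm sends −1 to (−1)ⁿ, so on the degenerate lines the transform of C_{Qⁿ} always is
-- (−1)ⁿ⁻¹ times the n-th power of that of C_Q; elsewhere this relation is the one between Jacobi sums.
module Submission where

open import Defs
open import Level using (0ℓ)
open import Algebra.Bundles using (CommutativeRing)
open import Data.Bool using (Bool; true; false; if_then_else_; _∨_)
open import Data.Fin as Fin using (Fin; zero; suc; toℕ; fromℕ<)
open import Data.Fin.Permutation using (permutation)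
import Data.Fin.Properties as Finₚ
open import Data.Integer as ℤ using (ℤ; +_; -[1+_]; _%ℕ_; _/ℕ_)
import Data.Integer.DivMod as ℤDM
open import Data.Integer.Divisibility as ℤD using ()
import Data.Integer.Divisibility.Signed as ℤDS
import Data.Integer.Properties as ℤₚ
open import Data.Integer.Tactic.RingSolver using (solve-∀)
open import Data.List using (foldr; map; tabulate; upTo; applyUpTo)
open import Data.Nat as ℕ using (ℕ; zero; suc; _≤_; _<_; _∸_; NonZero; z≤n; s≤s)
open import Data.Nat.Divisibility
  using (_∣_; _∤_; _∣?_; divides; ∣-trans; m%n≡0⇒n∣m; n∣m⇒m%n≡0; m∣m*n; ∣m⇒∣m*n; ∣n⇒∣m*n; ∣1⇒≡1)
open import Data.Nat.DivMod
  using (_/_; _%_; _mod_; m≡m%n+[m/n]*n; m%n<n; m%n%n≡m%n; %-distribˡ-+; [m+n]%n≡m%n; m<n⇒m%n≡m; m*[n/m]≡n; m/n*n≡m; m/n<m)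
open import Data.Nat.ListAction using () renaming (sum to sumℕ)
open import Data.Nat.Primality using (Prime; euclidsLemma; prime[2]; prime⇒irreducible)
import Data.Nat.Properties as ℕₚ
open import Data.Product using (∃-syntax; _×_; _,_; proj₁; proj₂)
open import Data.Sum using (_⊎_; inj₁; inj₂)
open import Function using (_∘_; id)
open import Function.Bundles using (_⇔_; mk⇔)
open import Relation.Binary using (tri<; tri≈; tri>)
open import Relation.Binary.PropositionalEquality as ≡ using (_≡_; _≢_)
open import Relation.Nullary using (¬_; yes; no; Dec; contradiction)
open import Relation.Nullary.Decidable using (⌊_⌋)

-- Cyclotomic numbers count solutions of 1 + x = y, so their transform is at first the shifted sum Σ
-- ψᵃ(α)ψᵇ(1 + α); the passage to the Jacobi sum by α ↦ -α is the source of the factor ψᵃ(-1) in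
-- front of it. The correction D_i F marks the class of log(-1) and is constant in j, hence its
-- transform vanishes unless e ∣ b. The sign (-1)ⁿ⁻¹ is forced by the degenerate lines: every value
-- there is -x with x = 1 or x = ψᵃ(-1)Q, the extension replaces x by xⁿ, and (-1)ⁿ⁻¹(-x)ⁿ = -xⁿ.
-- Off these lines ψᵃ(-1) is likewise replaced by its n-th power, and it can be cancelled because
-- its square is 1. Both fields are treated by one computation. The normalisation χ′(γ′) = ζ says
-- that the lifted character takes on powers of γ′ the values that χ takes on powers of γ, and these
-- values are all that the computation uses. Frequencies are natural numbers; integers a, b enter
-- only through their remainders mod e.

-- Powers, images of integers and finite sums in a commutative ring.

module RingSums (R : CommutativeRing 0ℓ 0ℓ) where
  open CommutativeRing R hiding (zero)
  open import Algebra.Properties.Semiring.Sum semiring public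
  open import Algebra.Properties.Semiring.Mult semiring using (×-homo-+; ×1-homo-*) renaming (_×_ to _·_)
  open import Algebra.Properties.CommutativeSemiring.Exp commutativeSemiring
    using (^-homo-*; ^-assocʳ; ^-congˡ; ^-distrib-*) renaming (_^_ to _^ʳ_)
  open import Algebra.Properties.Ring ring public
  open import Algebra.Properties.CommutativeSemigroup *-commutativeSemigroup public using (interchange)
  open import Relation.Binary.Reasoning.Setoid setoid

  infixr 8 _^_
  _^_ : Carrier → ℕ → Carrier
  _^_ = powR R

  fromℕ : ℕ → Carrier
  fromℕ = natR R

  ^≡^ʳ : ∀ x n → x ^ n ≡ x ^ʳ n
  ^≡^ʳ x zero    = ≡.refl
  ^≡^ʳ x (suc n) = ≡.cong (x *_) (^≡^ʳ x n)

  ^-cong : ∀ {x y} n → x ≈ y → x ^ n ≈ y ^ n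
  ^-cong {x} {y} n x≈y rewrite ^≡^ʳ x n | ^≡^ʳ y n = ^-congˡ n x≈y

  ^-+ : ∀ x m n → x ^ (m ℕ.+ n) ≈ x ^ m * x ^ n
  ^-+ x m n rewrite ^≡^ʳ x (m ℕ.+ n) | ^≡^ʳ x m | ^≡^ʳ x n = ^-homo-* x m n

  ^-* : ∀ x m n → x ^ (m ℕ.* n) ≈ (x ^ m) ^ n
  ^-* x m n rewrite ^≡^ʳ x (m ℕ.* n) | ^≡^ʳ (x ^ m) n | ^≡^ʳ x m = sym (^-assocʳ x m n)

  *-^ : ∀ x y n → (x * y) ^ n ≈ x ^ n * y ^ n
  *-^ x y n rewrite ^≡^ʳ (x * y) n | ^≡^ʳ x n | ^≡^ʳ y n = ^-distrib-* x y n

  1^ : ∀ n → 1# ^ n ≈ 1#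
  1^ zero    = refl
  1^ (suc n) = trans (*-identityˡ _) (1^ n)

  x≈1⇒x^n≈1 : ∀ {x} n → x ≈ 1# → x ^ n ≈ 1#
  x≈1⇒x^n≈1 n x≈1 = trans (^-cong n x≈1) (1^ n)

  fromℕ≡· : ∀ n → fromℕ n ≡ n · 1#
  fromℕ≡· zero    = ≡.refl
  fromℕ≡· (suc n) = ≡.cong (λ z → 1# + z) (fromℕ≡· n)

  fromℕ-+ : ∀ m n → fromℕ (m ℕ.+ n) ≈ fromℕ m + fromℕ n
  fromℕ-+ m n rewrite fromℕ≡· (m ℕ.+ n) | fromℕ≡· m | fromℕ≡· n = ×-homo-+ 1# m n

  fromℕ-* : ∀ m n → fromℕ (m ℕ.* n) ≈ fromℕ m * fromℕ n
  fromℕ-* m n rewrite fromℕ≡· (m ℕ.* n) | fromℕ≡· m | fromℕ≡· n = ×1-homo-* m n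

  fromℕ-1 : fromℕ 1 ≈ 1#
  fromℕ-1 = +-identityʳ 1#

  fromℕ-^ : ∀ m n → fromℕ (m ℕ.^ n) ≈ fromℕ m ^ n
  fromℕ-^ m zero    = fromℕ-1
  fromℕ-^ m (suc n) = trans (fromℕ-* m (m ℕ.^ n)) (*-congˡ (fromℕ-^ m n))

  x-0≈x : ∀ x → x - 0# ≈ x
  x-0≈x x = trans (+-congˡ -0#≈0#) (+-identityʳ x)

  [x+y]-x≈y : ∀ x y → (x + y) - x ≈ y
  [x+y]-x≈y x y = begin
    (x + y) - x    ≈⟨ +-congʳ (+-comm x y) ⟩
    (y + x) - x    ≈⟨ +-assoc y x (- x) ⟩
    y + (x - x)    ≈⟨ +-congˡ (-‿inverseʳ x) ⟩
    y + 0#         ≈⟨ +-identityʳ y ⟩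
    y              ∎

  *-distribʳ-- : ∀ x y z → (x - y) * z ≈ x * z - y * z
  *-distribʳ-- x y z = trans (distribʳ z x (- y)) (+-congˡ (sym (-‿distribˡ-* y z)))

  fromℤ : ℤ → Carrier
  fromℤ (+ n)    = fromℕ n
  fromℤ -[1+ n ] = - fromℕ (suc n)

  fromℤ-⊖ : ∀ m n → fromℤ (m ℤ.⊖ n) ≈ fromℕ m - fromℕ n
  fromℤ-⊖ zero    zero    = sym (-‿inverseʳ 0#)
  fromℤ-⊖ zero    (suc n) = sym (+-identityˡ _)
  fromℤ-⊖ (suc m) zero    = sym (x-0≈x _)
  fromℤ-⊖ (suc m) (suc n) = begin
    fromℤ (suc m ℤ.⊖ suc n)              ≡⟨ ≡.cong fromℤ (ℤₚ.[1+m]⊖[1+n]≡m⊖n m n) ⟩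
    fromℤ (m ℤ.⊖ n)                      ≈⟨ fromℤ-⊖ m n ⟩
    fromℕ m - fromℕ n                    ≈⟨ +-congʳ ([x+y]-x≈y 1# (fromℕ m)) ⟨
    ((1# + fromℕ m) - 1#) - fromℕ n      ≈⟨ +-assoc _ _ _ ⟩
    (1# + fromℕ m) + (- 1# - fromℕ n)    ≈⟨ +-congˡ (-‿+-comm 1# (fromℕ n)) ⟩
    (1# + fromℕ m) - (1# + fromℕ n)      ∎

  fromℤ-+ : ∀ i j → fromℤ (i ℤ.+ j) ≈ fromℤ i + fromℤ j
  fromℤ-+ (+ m)    (+ n)    = fromℕ-+ m n
  fromℤ-+ (+ m)    -[1+ n ] = fromℤ-⊖ m (suc n)
  fromℤ-+ -[1+ m ] (+ n)    = trans (fromℤ-⊖ n (suc m)) (+-comm _ _)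
  fromℤ-+ -[1+ m ] -[1+ n ] = begin
    - fromℕ (suc (suc (m ℕ.+ n)))         ≡⟨ ≡.cong (λ k → - fromℕ (suc k)) (≡.sym (ℕₚ.+-suc m n)) ⟩
    - fromℕ (suc m ℕ.+ suc n)             ≈⟨ -‿cong (fromℕ-+ (suc m) (suc n)) ⟩
    - (fromℕ (suc m) + fromℕ (suc n))     ≈⟨ -‿+-comm _ _ ⟨
    - fromℕ (suc m) - fromℕ (suc n)       ∎

  fromℤ-neg : ∀ i → fromℤ (ℤ.- i) ≈ - fromℤ i
  fromℤ-neg (+ zero)  = sym -0#≈0#
  fromℤ-neg (+ suc n) = refl
  fromℤ-neg -[1+ n ]  = sym (-‿involutive _)

  fromℤ-pos* : ∀ m j → fromℤ (+ m ℤ.* j) ≈ fromℕ m * fromℤ j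
  fromℤ-pos* m (+ n) = begin
    fromℤ (+ m ℤ.* + n)   ≡⟨ ≡.cong fromℤ (ℤₚ.pos-* m n) ⟨
    fromℕ (m ℕ.* n)       ≈⟨ fromℕ-* m n ⟩
    fromℕ m * fromℕ n     ∎
  fromℤ-pos* m -[1+ n ] = begin
    fromℤ (+ m ℤ.* ℤ.- + suc n)    ≡⟨ ≡.cong fromℤ (ℤₚ.neg-distribʳ-* (+ m) (+ suc n)) ⟨
    fromℤ (ℤ.- (+ m ℤ.* + suc n))  ≈⟨ fromℤ-neg (+ m ℤ.* + suc n) ⟩
    - fromℤ (+ m ℤ.* + suc n)      ≈⟨ -‿cong (fromℤ-pos* m (+ suc n)) ⟩
    - (fromℕ m * fromℕ (suc n))    ≈⟨ -‿distribʳ-* _ _ ⟩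
    fromℕ m * - fromℕ (suc n)      ∎

  fromℤ-* : ∀ i j → fromℤ (i ℤ.* j) ≈ fromℤ i * fromℤ j
  fromℤ-* (+ m)    j = fromℤ-pos* m j
  fromℤ-* -[1+ m ] j = begin
    fromℤ (ℤ.- + suc m ℤ.* j)      ≡⟨ ≡.cong fromℤ (ℤₚ.neg-distribˡ-* (+ suc m) j) ⟨
    fromℤ (ℤ.- (+ suc m ℤ.* j))    ≈⟨ fromℤ-neg (+ suc m ℤ.* j) ⟩
    - fromℤ (+ suc m ℤ.* j)        ≈⟨ -‿cong (fromℤ-pos* (suc m) j) ⟩
    - (fromℕ (suc m) * fromℤ j)    ≈⟨ -‿distribˡ-* _ _ ⟩
    - fromℕ (suc m) * fromℤ j      ∎

  fromℤ-^ : ∀ i n → fromℤ (i ℤ.^ n) ≈ fromℤ i ^ n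
  fromℤ-^ i zero    = fromℕ-1
  fromℤ-^ i (suc n) = trans (fromℤ-* i (i ℤ.^ n)) (*-congˡ (fromℤ-^ i n))

  -- `allFin n` is `tabulate id` and its tail is `tabulate suc`, so the induction has to run over an
  -- arbitrary enumeration `h`.
  sumR≡sum : ∀ {n} (f : Fin n → Carrier) → sumR R f ≡ sum f
  sumR≡sum f = go id
    where
    go : ∀ {m} (h : Fin m → Fin _) →
         foldr (λ α s → f α + s) 0# (tabulate h) ≡ sum (f ∘ h)
    go {zero}  h = ≡.refl
    go {suc m} h = ≡.cong (λ z → f (h zero) + z) (go (h ∘ suc))

  fromℤ-sumℤ : ∀ {n} (f : Fin n → ℤ) → fromℤ (sumℤ f) ≈ sum (fromℤ ∘ f)
  fromℤ-sumℤ f = go id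
    where
    go : ∀ {m} (h : Fin m → Fin _) →
         fromℤ (foldr (λ s acc → f s ℤ.+ acc) (+ 0) (tabulate h)) ≈ sum (fromℤ ∘ f ∘ h)
    go {zero}  h = refl
    go {suc m} h = trans (fromℤ-+ (f (h zero)) _) (+-congˡ (go (h ∘ suc)))

  sum-cong : ∀ {n} {f g : Fin n → Carrier} → (∀ i → f i ≈ g i) → sum f ≈ sum g
  sum-cong = sum-cong-≋

  sum-zero : ∀ {n} {f : Fin n → Carrier} → (∀ i → f i ≈ 0#) → sum f ≈ 0#
  sum-zero {n} f≈0 = trans (sum-cong f≈0) (sum-replicate-zero n)

  sum-neg : ∀ {n} (f : Fin n → Carrier) → sum (λ i → - f i) ≈ - sum f
  sum-neg {zero}  f = sym -0#≈0#
  sum-neg {suc n} f = trans (+-congˡ (sum-neg (f ∘ suc))) (-‿+-comm _ _)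

  sum-- : ∀ {n} (f g : Fin n → Carrier) → sum (λ i → f i - g i) ≈ sum f - sum g
  sum-- f g = trans (∑-distrib-+ f (λ i → - g i)) (+-congˡ (sum-neg g))

  sum-const : ∀ n x → sum {n} (λ _ → x) ≈ fromℕ n * x
  sum-const zero    x = sym (zeroˡ x)
  sum-const (suc n) x = begin
    x + sum {n} (λ _ → x)        ≈⟨ +-cong (sym (*-identityˡ x)) (sum-const n x) ⟩
    1# * x + fromℕ n * x         ≈⟨ distribʳ x 1# (fromℕ n) ⟨
    (1# + fromℕ n) * x           ∎

  [_] : Bool → Carrier
  [ b ] = if b then 1# else 0#

  sum-δ : ∀ {n} (i₀ : Fin n) (f : Fin n → Carrier) → sum (λ i → [ ⌊ i Fin.≟ i₀ ⌋ ] * f i) ≈ f i₀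
  sum-δ {suc n} i₀ f = begin
    sum (λ i → [ ⌊ i Fin.≟ i₀ ⌋ ] * f i)      ≈⟨ sum-remove {i = i₀} (λ i → [ ⌊ i Fin.≟ i₀ ⌋ ] * f i) ⟩
    [ ⌊ i₀ Fin.≟ i₀ ⌋ ] * f i₀ + _            ≈⟨ +-cong hit (sum-zero miss) ⟩
    f i₀ + 0#                                 ≈⟨ +-identityʳ _ ⟩
    f i₀                                      ∎
    where
    hit : [ ⌊ i₀ Fin.≟ i₀ ⌋ ] * f i₀ ≈ f i₀
    hit with i₀ Fin.≟ i₀
    ... | yes _   = *-identityˡ _
    ... | no i₀≢i₀ = contradiction ≡.refl i₀≢i₀
    miss : ∀ j → [ ⌊ Fin.punchIn i₀ j Fin.≟ i₀ ⌋ ] * f (Fin.punchIn i₀ j) ≈ 0#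
    miss j with Fin.punchIn i₀ j Fin.≟ i₀
    ... | yes eq = contradiction eq (Finₚ.punchInᵢ≢i i₀ j)
    ... | no _   = zeroˡ _

  -- The summand lives on ℕ, so that exponents such as e v + i can be rearranged without casts
  -- between finite types.
  ∑< : ℕ → (ℕ → Carrier) → Carrier
  ∑< n h = sum {n} (h ∘ toℕ)

  ∑<-+ : ∀ m n h → ∑< (m ℕ.+ n) h ≈ ∑< m h + ∑< n (h ∘ (m ℕ.+_))
  ∑<-+ zero    n h = sym (+-identityˡ _)
  ∑<-+ (suc m) n h = trans (+-congˡ (∑<-+ m n (h ∘ suc))) (sym (+-assoc _ _ _))

  -- Division with remainder by e, in the form in which the cyclotomic numbers write their
  -- exponents.
  ∑<-* : ∀ f e h → ∑< (f ℕ.* e) h ≈ ∑< f (λ v → ∑< e (λ i → h (e ℕ.* v ℕ.+ i)))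
  ∑<-* zero    e h = refl
  ∑<-* (suc f) e h = begin
    ∑< (e ℕ.+ f ℕ.* e) h
      ≈⟨ ∑<-+ e (f ℕ.* e) h ⟩
    ∑< e h + ∑< (f ℕ.* e) (h ∘ (e ℕ.+_))
      ≈⟨ +-cong (sum-cong {e} (λ i → reflexive (≡.cong (λ z → h (z ℕ.+ toℕ i)) (≡.sym (ℕₚ.*-zeroʳ e)))))
                (∑<-* f e (h ∘ (e ℕ.+_))) ⟩
    ∑< e (λ i → h (e ℕ.* 0 ℕ.+ i)) + ∑< f (λ v → ∑< e (λ i → h (e ℕ.+ (e ℕ.* v ℕ.+ i))))
      ≈⟨ +-congˡ (sum-cong {f} (λ v → sum-cong {e} (λ i → reflexive (≡.cong h (shift (toℕ v) (toℕ i)))))) ⟩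
    ∑< e (λ i → h (e ℕ.* 0 ℕ.+ i)) + ∑< f (λ v → ∑< e (λ i → h (e ℕ.* suc v ℕ.+ i))) ∎
    where
    shift : ∀ v i → e ℕ.+ (e ℕ.* v ℕ.+ i) ≡ e ℕ.* suc v ℕ.+ i
    shift v i = ≡.trans (≡.sym (ℕₚ.+-assoc e (e ℕ.* v) i)) (≡.cong (ℕ._+ i) (≡.sym (ℕₚ.*-suc e v)))

  fromℕ-sum-upTo : ∀ n (h : ℕ → ℕ) → fromℕ (sumℕ (map h (upTo n))) ≈ ∑< n (fromℕ ∘ h)
  fromℕ-sum-upTo n h = go n id
    where
    go : ∀ n (u : ℕ → ℕ) → fromℕ (sumℕ (map h (applyUpTo u n))) ≈ ∑< n (fromℕ ∘ h ∘ u)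
    go zero    u = refl
    go (suc n) u = trans (fromℕ-+ (h (u 0)) _) (+-congˡ (go n (u ∘ suc)))

  -- Kept as a product because R has no division; a domain allows 1 - x to be cancelled later.
  ∑<-geometric : ∀ x n → ∑< n (x ^_) * (1# - x) ≈ 1# - x ^ n
  ∑<-geometric x zero    = trans (zeroˡ _) (sym (-‿inverseʳ 1#))
  ∑<-geometric x (suc n) = begin
    (1# + sum {n} (λ i → x * x ^ toℕ i)) * (1# - x)
      ≈⟨ *-congʳ (+-congˡ (*-distribˡ-sum {n} x (λ i → x ^ toℕ i))) ⟨
    (1# + x * ∑< n (x ^_)) * (1# - x)
      ≈⟨ distribʳ _ _ _ ⟩
    1# * (1# - x) + x * ∑< n (x ^_) * (1# - x)
      ≈⟨ +-cong (*-identityˡ _) (trans (*-assoc _ _ _) (*-congˡ (∑<-geometric x n))) ⟩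
    (1# - x) + x * (1# - x ^ n)
      ≈⟨ +-congˡ (trans (distribˡ x 1# _) (+-cong (*-identityʳ x) (sym (-‿distribʳ-* x (x ^ n))))) ⟩
    (1# - x) + (x - x * x ^ n)
      ≈⟨ +-assoc 1# (- x) _ ⟩
    1# + (- x + (x - x * x ^ n))
      ≈⟨ +-congˡ (+-assoc (- x) x _) ⟨
    1# + ((- x + x) - x * x ^ n)
      ≈⟨ +-congˡ (trans (+-congʳ (-‿inverseˡ x)) (+-identityˡ _)) ⟩
    1# - x * x ^ n ∎

-- Residues modulo e.

module ModularSubtraction (e : ℕ) .{{_ : NonZero e}} where

  toℕ-mod : ∀ k → toℕ (k mod e) ≡ k % e
  toℕ-mod k = Finₚ.toℕ-fromℕ< (m%n<n k e)

  -- The inverse of `subMod e _ s`; it exhibits subtraction of s as a permutation of the indices.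
  addMod : Fin e → Fin e → Fin e
  addMod i s = (toℕ i ℕ.+ toℕ s) mod e

  %-absorbˡ : ∀ m n → (m % e ℕ.+ n) % e ≡ (m ℕ.+ n) % e
  %-absorbˡ m n = begin
    (m % e ℕ.+ n) % e              ≡⟨ %-distribˡ-+ (m % e) n e ⟩
    (m % e % e ℕ.+ n % e) % e      ≡⟨ ≡.cong (λ z → (z ℕ.+ n % e) % e) (m%n%n≡m%n m e) ⟩
    (m % e ℕ.+ n % e) % e          ≡⟨ %-distribˡ-+ m n e ⟨
    (m ℕ.+ n) % e                  ∎
    where open ≡.≡-Reasoning

  toℕ-%-self : ∀ (i : Fin e) → toℕ i % e ≡ toℕ i
  toℕ-%-self i = m<n⇒m%n≡m (Finₚ.toℕ<n i)

  toℕ-subMod+ : ∀ i s → (toℕ (subMod e i s) ℕ.+ toℕ s) % e ≡ toℕ i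
  toℕ-subMod+ i s = begin
    (toℕ (subMod e i s) ℕ.+ toℕ s) % e                  ≡⟨ ≡.cong (λ z → (z ℕ.+ toℕ s) % e) (toℕ-mod _) ⟩
    ((toℕ i ℕ.+ (e ∸ toℕ s)) % e ℕ.+ toℕ s) % e         ≡⟨ %-absorbˡ (toℕ i ℕ.+ (e ∸ toℕ s)) (toℕ s) ⟩
    (toℕ i ℕ.+ (e ∸ toℕ s) ℕ.+ toℕ s) % e               ≡⟨ ≡.cong (_% e) (ℕₚ.+-assoc (toℕ i) _ _) ⟩
    (toℕ i ℕ.+ (e ∸ toℕ s ℕ.+ toℕ s)) % e               ≡⟨ ≡.cong (λ z → (toℕ i ℕ.+ z) % e) (ℕₚ.m∸n+n≡m (Finₚ.toℕ≤n s)) ⟩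
    (toℕ i ℕ.+ e) % e                                   ≡⟨ [m+n]%n≡m%n (toℕ i) e ⟩
    toℕ i % e                                           ≡⟨ toℕ-%-self i ⟩
    toℕ i                                               ∎
    where open ≡.≡-Reasoning

  addMod-subMod : ∀ i s → addMod (subMod e i s) s ≡ i
  addMod-subMod i s = Finₚ.toℕ-injective (≡.trans (toℕ-mod _) (toℕ-subMod+ i s))

  subMod-addMod : ∀ i s → subMod e (addMod i s) s ≡ i
  subMod-addMod i s = Finₚ.toℕ-injective (begin
    toℕ (subMod e (addMod i s) s)                       ≡⟨ toℕ-mod _ ⟩
    (toℕ (addMod i s) ℕ.+ (e ∸ toℕ s)) % e              ≡⟨ ≡.cong (λ z → (z ℕ.+ (e ∸ toℕ s)) % e) (toℕ-mod _) ⟩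
    ((toℕ i ℕ.+ toℕ s) % e ℕ.+ (e ∸ toℕ s)) % e         ≡⟨ %-absorbˡ (toℕ i ℕ.+ toℕ s) (e ∸ toℕ s) ⟩
    (toℕ i ℕ.+ toℕ s ℕ.+ (e ∸ toℕ s)) % e               ≡⟨ ≡.cong (_% e) (ℕₚ.+-assoc (toℕ i) _ _) ⟩
    (toℕ i ℕ.+ (toℕ s ℕ.+ (e ∸ toℕ s))) % e             ≡⟨ ≡.cong (λ z → (toℕ i ℕ.+ z) % e) (ℕₚ.m+[n∸m]≡n (Finₚ.toℕ≤n s)) ⟩
    (toℕ i ℕ.+ e) % e                                   ≡⟨ [m+n]%n≡m%n (toℕ i) e ⟩
    toℕ i % e                                           ≡⟨ toℕ-%-self i ⟩
    toℕ i                                               ∎)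
    where open ≡.≡-Reasoning

  -- The sum represents i - i₀ modulo e by a natural number; it is the exponent that occurs in the
  -- orthogonality relation.
  ∣shift⇒≡ : ∀ (i i₀ : Fin e) → e ∣ toℕ i ℕ.+ (e ∸ toℕ i₀) → i ≡ i₀
  ∣shift⇒≡ i i₀ e∣ = ≡.trans (≡.sym (addMod-subMod i i₀)) (Finₚ.toℕ-injective (begin
    toℕ (addMod (subMod e i i₀) i₀)                     ≡⟨ toℕ-mod _ ⟩
    (toℕ (subMod e i i₀) ℕ.+ toℕ i₀) % e                ≡⟨ ≡.cong (λ z → (z ℕ.+ toℕ i₀) % e) (≡.trans (toℕ-mod _) (n∣m⇒m%n≡0 _ e e∣)) ⟩
    toℕ i₀ % e                                          ≡⟨ toℕ-%-self i₀ ⟩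
    toℕ i₀                                              ∎))
    where open ≡.≡-Reasoning

-- The discrete Fourier transform on ℤ/e and its square.

module Fourier (R : CommutativeRing 0ℓ 0ℓ) (domain : IsCharZeroDomain R)
               (e : ℕ) .{{_ : NonZero e}} (ζ : CommutativeRing.Carrier R)
               (ζ-prim : IsPrimitiveRoot R e ζ) where
  open CommutativeRing R hiding (zero)
  open RingSums R
  open ModularSubtraction e
  open import Relation.Binary.Reasoning.Setoid setoid

  x*y≈0⇒x≈0 : ∀ {x y} → ¬ y ≈ 0# → x * y ≈ 0# → x ≈ 0#
  x*y≈0⇒x≈0 y≉0 xy≈0 with proj₁ domain _ _ xy≈0
  ... | inj₁ x≈0 = x≈0
  ... | inj₂ y≈0 = contradiction y≈0 y≉0

  x-y≈0⇒x≈y : ∀ {x y} → x - y ≈ 0# → x ≈ y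
  x-y≈0⇒x≈y {x} {y} = x∙y⁻¹≈ε⇒x≈y x y

  *-cancelʳ-domain : ∀ {x y} z → ¬ z ≈ 0# → x * z ≈ y * z → x ≈ y
  *-cancelʳ-domain {x} {y} z z≉0 xz≈yz = x-y≈0⇒x≈y (x*y≈0⇒x≈0 z≉0 (begin
    (x - y) * z      ≈⟨ *-distribʳ-- x y z ⟩
    x * z - y * z    ≈⟨ +-congʳ xz≈yz ⟩
    y * z - y * z    ≈⟨ -‿inverseʳ _ ⟩
    0#               ∎))

  fromℤ-≈0 : ∀ i → fromℤ i ≈ 0# → i ≡ + 0
  fromℤ-≈0 (+ n)    eq = ≡.cong +_ (proj₂ domain n eq)
  fromℤ-≈0 -[1+ n ] eq = contradiction (proj₂ domain (suc n) (begin
    fromℕ (suc n)        ≈⟨ -‿involutive _ ⟨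
    - - fromℕ (suc n)    ≈⟨ -‿cong eq ⟩
    - 0#                 ≈⟨ -0#≈0# ⟩
    0#                   ∎)) λ ()

  fromℤ-injective : ∀ i j → fromℤ i ≈ fromℤ j → i ≡ j
  fromℤ-injective i j eq = ℤₚ.i-j≡0⇒i≡j i j (fromℤ-≈0 (i ℤ.- j) (begin
    fromℤ (i ℤ.- j)        ≈⟨ fromℤ-+ i (ℤ.- j) ⟩
    fromℤ i + fromℤ (ℤ.- j) ≈⟨ +-cong eq (fromℤ-neg j) ⟩
    fromℤ j - fromℤ j      ≈⟨ -‿inverseʳ _ ⟩
    0#                     ∎))

  fromℕe≉0 : ¬ fromℕ e ≈ 0#
  fromℕe≉0 eq = ℕ.≢-nonZero⁻¹ e (proj₂ domain e eq)

  ζ^e≈1 : ζ ^ e ≈ 1#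
  ζ^e≈1 = proj₁ ζ-prim

  e∣k⇒ζ^k≈1 : ∀ {k} → e ∣ k → ζ ^ k ≈ 1#
  e∣k⇒ζ^k≈1 (divides q ≡.refl) = begin
    ζ ^ (q ℕ.* e)    ≡⟨ ≡.cong (ζ ^_) (ℕₚ.*-comm q e) ⟩
    ζ ^ (e ℕ.* q)    ≈⟨ ^-* ζ e q ⟩
    (ζ ^ e) ^ q      ≈⟨ x≈1⇒x^n≈1 q ζ^e≈1 ⟩
    1#               ∎

  ζ^% : ∀ k → ζ ^ (k % e) ≈ ζ ^ k
  ζ^% k = begin
    ζ ^ (k % e)                            ≈⟨ *-identityʳ _ ⟨
    ζ ^ (k % e) * 1#                       ≈⟨ *-congˡ (e∣k⇒ζ^k≈1 (divides (k / e) ≡.refl)) ⟨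
    ζ ^ (k % e) * ζ ^ (k / e ℕ.* e)        ≈⟨ ^-+ ζ (k % e) _ ⟨
    ζ ^ (k % e ℕ.+ k / e ℕ.* e)            ≡⟨ ≡.cong (ζ ^_) (m≡m%n+[m/n]*n k e) ⟨
    ζ ^ k                                  ∎

  -- A nonzero remainder of k would be an exponent between 0 and e at which ζ gives 1, against
  -- primitivity.
  ζ^k≈1⇒e∣k : ∀ k → ζ ^ k ≈ 1# → e ∣ k
  ζ^k≈1⇒e∣k k eq with k % e in k%e≡
  ... | zero  = m%n≡0⇒n∣m k e k%e≡
  ... | suc r = contradiction (trans (reflexive (≡.cong (ζ ^_) (≡.sym k%e≡))) (trans (ζ^% k) eq))
                  (proj₂ ζ-prim (suc r) (s≤s z≤n) (≡.subst (_< e) k%e≡ (m%n<n k e)))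

  -- The length n is free because the lemma serves twice: n = e for orthogonality and n = q - 1 for
  -- character sums over a field.
  ∑<-root : ∀ n {x} → x ^ n ≈ 1# → ¬ x ≈ 1# → ∑< n (x ^_) ≈ 0#
  ∑<-root n {x} x^n≈1 x≉1 = x*y≈0⇒x≈0 (λ eq → x≉1 (sym (x-y≈0⇒x≈y eq))) (begin
    ∑< n (x ^_) * (1# - x)    ≈⟨ ∑<-geometric x n ⟩
    1# - x ^ n                ≈⟨ +-congˡ (-‿cong x^n≈1) ⟩
    1# - 1#                   ≈⟨ -‿inverseʳ 1# ⟩
    0#                        ∎)

  ∑<-one : ∀ n {x} → x ≈ 1# → ∑< n (x ^_) ≈ fromℕ n
  ∑<-one n {x} x≈1 = begin
    ∑< n (x ^_)               ≈⟨ sum-cong {n} (λ i → x≈1⇒x^n≈1 (toℕ i) x≈1) ⟩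
    sum {n} (λ _ → 1#)        ≈⟨ sum-const n 1# ⟩
    fromℕ n * 1#              ≈⟨ *-identityʳ _ ⟩
    fromℕ n                   ∎

  [ζ^k]^e≈1 : ∀ k → (ζ ^ k) ^ e ≈ 1#
  [ζ^k]^e≈1 k = begin
    (ζ ^ k) ^ e     ≈⟨ ^-* ζ k e ⟨
    ζ ^ (k ℕ.* e)   ≈⟨ e∣k⇒ζ^k≈1 (divides k ≡.refl) ⟩
    1#              ∎

  DFT : (Fin e → Carrier) → ℕ → Carrier
  DFT x a = sum (λ i → x i * ζ ^ (a ℕ.* toℕ i))

  DFT-cong : ∀ {x y} a → (∀ i → x i ≈ y i) → DFT x a ≈ DFT y a
  DFT-cong a x≈y = sum-cong (λ i → *-congʳ (x≈y i))

  DFT-scale : ∀ c x a → DFT (λ i → c * x i) a ≈ c * DFT x a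
  DFT-scale c x a = begin
    DFT (λ i → c * x i) a                          ≈⟨ sum-cong (λ i → *-assoc c (x i) _) ⟩
    sum (λ i → c * (x i * ζ ^ (a ℕ.* toℕ i)))      ≈⟨ *-distribˡ-sum c (λ i → x i * ζ ^ (a ℕ.* toℕ i)) ⟨
    c * DFT x a                                    ∎

  DFT-sum : ∀ {n} (x : Fin n → Fin e → Carrier) a → DFT (λ i → sum (λ s → x s i)) a ≈ sum (λ s → DFT (x s) a)
  DFT-sum {n} x a = begin
    DFT (λ i → sum (λ s → x s i)) a                                   ≈⟨ sum-cong (λ i → *-distribʳ-sum (ζ ^ (a ℕ.* toℕ i)) (λ s → x s i)) ⟩
    sum (λ i → sum (λ s → x s i * ζ ^ (a ℕ.* toℕ i)))                 ≈⟨ ∑-comm {e} {n} (λ i s → x s i * ζ ^ (a ℕ.* toℕ i)) ⟩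
    sum (λ s → DFT (x s) a)                                           ∎

  -- R need not contain 1/e, so the inversion stays unnormalised. The kernel with e - i₀ stands for
  -- ζ^(-a i₀), and the sum over a of the powers of ζ^(i - i₀) is e or 0.
  DFT-inversion : ∀ x i₀ → sum (λ (a : Fin e) → DFT x (toℕ a) * ζ ^ (toℕ a ℕ.* (e ∸ toℕ i₀))) ≈ x i₀ * fromℕ e
  DFT-inversion x i₀ = begin
    sum {e} (λ a → DFT x (toℕ a) * ζ ^ (toℕ a ℕ.* c))
      ≈⟨ sum-cong {e} (λ a → *-distribʳ-sum (ζ ^ (toℕ a ℕ.* c)) (λ i → x i * ζ ^ (toℕ a ℕ.* toℕ i))) ⟩
    sum {e} (λ a → sum (λ i → x i * ζ ^ (toℕ a ℕ.* toℕ i) * ζ ^ (toℕ a ℕ.* c)))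
      ≈⟨ sum-cong {e} (λ a → sum-cong {e} (λ i → term a i)) ⟩
    sum {e} (λ a → sum (λ i → x i * (ζ ^ (toℕ i ℕ.+ c)) ^ toℕ a))
      ≈⟨ ∑-comm {e} {e} (λ a i → x i * (ζ ^ (toℕ i ℕ.+ c)) ^ toℕ a) ⟩
    sum (λ i → sum {e} (λ a → x i * (ζ ^ (toℕ i ℕ.+ c)) ^ toℕ a))
      ≈⟨ sum-cong {e} (λ i → *-distribˡ-sum {e} (x i) (λ a → (ζ ^ (toℕ i ℕ.+ c)) ^ toℕ a)) ⟨
    sum (λ i → x i * ∑< e ((ζ ^ (toℕ i ℕ.+ c)) ^_))
      ≈⟨ sum-cong {e} orthogonal ⟩
    sum (λ i → [ ⌊ i Fin.≟ i₀ ⌋ ] * (x i * fromℕ e))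
      ≈⟨ sum-δ i₀ (λ i → x i * fromℕ e) ⟩
    x i₀ * fromℕ e ∎
    where
    c = e ∸ toℕ i₀
    term : ∀ (a i : Fin e) → x i * ζ ^ (toℕ a ℕ.* toℕ i) * ζ ^ (toℕ a ℕ.* c) ≈ x i * (ζ ^ (toℕ i ℕ.+ c)) ^ toℕ a
    term a i = begin
      x i * ζ ^ (toℕ a ℕ.* toℕ i) * ζ ^ (toℕ a ℕ.* c)      ≈⟨ *-assoc _ _ _ ⟩
      x i * (ζ ^ (toℕ a ℕ.* toℕ i) * ζ ^ (toℕ a ℕ.* c))    ≈⟨ *-congˡ (^-+ ζ (toℕ a ℕ.* toℕ i) _) ⟨
      x i * ζ ^ (toℕ a ℕ.* toℕ i ℕ.+ toℕ a ℕ.* c)          ≡⟨ ≡.cong (λ k → x i * ζ ^ k) (≡.trans (≡.sym (ℕₚ.*-distribˡ-+ (toℕ a) (toℕ i) c)) (ℕₚ.*-comm (toℕ a) _)) ⟩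
      x i * ζ ^ ((toℕ i ℕ.+ c) ℕ.* toℕ a)                  ≈⟨ *-congˡ (^-* ζ (toℕ i ℕ.+ c) (toℕ a)) ⟩
      x i * (ζ ^ (toℕ i ℕ.+ c)) ^ toℕ a                    ∎
    orthogonal : ∀ i → x i * ∑< e ((ζ ^ (toℕ i ℕ.+ c)) ^_) ≈ [ ⌊ i Fin.≟ i₀ ⌋ ] * (x i * fromℕ e)
    orthogonal i with i Fin.≟ i₀
    ... | yes ≡.refl = trans (*-congˡ (∑<-one e (e∣k⇒ζ^k≈1 (divides 1 (≡.trans (ℕₚ.m+[n∸m]≡n (Finₚ.toℕ≤n i)) (≡.sym (ℕₚ.*-identityˡ e)))))))
                             (sym (*-identityˡ _))
    ... | no i≢i₀ = begin
      x i * ∑< e ((ζ ^ (toℕ i ℕ.+ c)) ^_)   ≈⟨ *-congˡ (∑<-root e ([ζ^k]^e≈1 (toℕ i ℕ.+ c)) (λ eq → i≢i₀ (∣shift⇒≡ i i₀ (ζ^k≈1⇒e∣k _ eq)))) ⟩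
      x i * 0#                              ≈⟨ zeroʳ _ ⟩
      0#                                    ≈⟨ zeroˡ _ ⟨
      0# * (x i * fromℕ e)                  ∎

  DFT-injective : ∀ x y → (∀ (a : Fin e) → DFT x (toℕ a) ≈ DFT y (toℕ a)) → ∀ i → x i ≈ y i
  DFT-injective x y eq i = *-cancelʳ-domain (fromℕ e) fromℕe≉0 (begin
    x i * fromℕ e                                                    ≈⟨ DFT-inversion x i ⟨
    sum {e} (λ a → DFT x (toℕ a) * ζ ^ (toℕ a ℕ.* (e ∸ toℕ i)))          ≈⟨ sum-cong {e} (λ a → *-congʳ (eq a)) ⟩
    sum {e} (λ a → DFT y (toℕ a) * ζ ^ (toℕ a ℕ.* (e ∸ toℕ i)))          ≈⟨ DFT-inversion y i ⟩
    y i * fromℕ e                                                    ∎)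

  -- The reduction mod e inside `subMod` is invisible to ζ; the factor a is moved to an outer power
  -- so that it can be undone in the exponent of ζ itself.
  ζ^-subMod : ∀ a i s → ζ ^ (a ℕ.* toℕ i) ≈ ζ ^ (a ℕ.* toℕ s) * ζ ^ (a ℕ.* toℕ (subMod e i s))
  ζ^-subMod a i s = begin
    ζ ^ (a ℕ.* toℕ i)                              ≡⟨ ≡.cong (ζ ^_) (ℕₚ.*-comm a (toℕ i)) ⟩
    ζ ^ (toℕ i ℕ.* a)                              ≈⟨ ^-* ζ (toℕ i) a ⟩
    (ζ ^ toℕ i) ^ a                                ≡⟨ ≡.cong (λ k → (ζ ^ k) ^ a) (toℕ-subMod+ i s) ⟨
    (ζ ^ ((d ℕ.+ toℕ s) % e)) ^ a                  ≈⟨ ^-cong a (ζ^% (d ℕ.+ toℕ s)) ⟩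
    (ζ ^ (d ℕ.+ toℕ s)) ^ a                        ≈⟨ ^-* ζ (d ℕ.+ toℕ s) a ⟨
    ζ ^ ((d ℕ.+ toℕ s) ℕ.* a)                      ≡⟨ ≡.cong (ζ ^_) (≡.trans (ℕₚ.*-comm (d ℕ.+ toℕ s) a) (≡.trans (≡.cong (a ℕ.*_) (ℕₚ.+-comm d (toℕ s))) (ℕₚ.*-distribˡ-+ a (toℕ s) d))) ⟩
    ζ ^ (a ℕ.* toℕ s ℕ.+ a ℕ.* d)                  ≈⟨ ^-+ ζ (a ℕ.* toℕ s) (a ℕ.* d) ⟩
    ζ ^ (a ℕ.* toℕ s) * ζ ^ (a ℕ.* d)              ∎
    where d = toℕ (subMod e i s)

  sum-subMod : ∀ s f → sum (λ i → f (subMod e i s)) ≈ sum f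
  sum-subMod s f = sym (sum-permute f
    (permutation (λ i → subMod e i s) (λ i → addMod i s) (λ i → subMod-addMod i s) (λ i → addMod-subMod i s)))

  -- For fixed s the kernel at i splits over i = s + (i - s), and i ↦ i - s permutes the indices, so
  -- the inner sum no longer depends on s.
  DFT-convolution : ∀ x y a → DFT (λ i → sum (λ s → x s * y (subMod e i s))) a ≈ DFT x a * DFT y a
  DFT-convolution x y a = begin
    DFT (λ i → sum (λ s → x s * y (subMod e i s))) a
      ≈⟨ DFT-sum (λ s i → x s * y (subMod e i s)) a ⟩
    sum (λ s → DFT (λ i → x s * y (subMod e i s)) a)
      ≈⟨ sum-cong {e} (λ s → sum-cong {e} (λ i → trans (*-congˡ (ζ^-subMod a i s)) (interchange _ _ _ _))) ⟩
    sum (λ s → sum (λ i → (x s * ζ ^ (a ℕ.* toℕ s)) * (y (subMod e i s) * ζ ^ (a ℕ.* toℕ (subMod e i s)))))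
      ≈⟨ sum-cong {e} (λ s → *-distribˡ-sum (x s * ζ ^ (a ℕ.* toℕ s)) (λ i → y (subMod e i s) * ζ ^ (a ℕ.* toℕ (subMod e i s)))) ⟨
    sum (λ s → (x s * ζ ^ (a ℕ.* toℕ s)) * sum (λ i → y (subMod e i s) * ζ ^ (a ℕ.* toℕ (subMod e i s))))
      ≈⟨ sum-cong {e} (λ s → *-congˡ (sum-subMod s (λ i → y i * ζ ^ (a ℕ.* toℕ i)))) ⟩
    sum (λ s → (x s * ζ ^ (a ℕ.* toℕ s)) * DFT y a)
      ≈⟨ *-distribʳ-sum (DFT y a) (λ s → x s * ζ ^ (a ℕ.* toℕ s)) ⟨
    DFT x a * DFT y a ∎

  DFT² : Matrix e → ℕ → ℕ → Carrier
  DFT² A a b = DFT (λ i → DFT (λ j → fromℤ (A i j)) b) a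

  DFT²-injective : ∀ A B → (∀ (a b : Fin e) → DFT² A (toℕ a) (toℕ b) ≈ DFT² B (toℕ a) (toℕ b)) → ∀ i j → A i j ≡ B i j
  DFT²-injective A B eq i j = fromℤ-injective _ _
    (DFT-injective (λ j → fromℤ (A i j)) (λ j → fromℤ (B i j))
      (λ b → DFT-injective (λ i → DFT (λ j → fromℤ (A i j)) (toℕ b)) (λ i → DFT (λ j → fromℤ (B i j)) (toℕ b)) (λ a → eq a b) i) j)

  DFT²-cong : ∀ {A B} a b → (∀ i j → A i j ≡ B i j) → DFT² A a b ≈ DFT² B a b
  DFT²-cong a b A≡B = DFT-cong a (λ i → DFT-cong b (λ j → reflexive (≡.cong fromℤ (A≡B i j))))

  DFT²-scale : ∀ c A a b → DFT² (λ i j → c ℤ.* A i j) a b ≈ fromℤ c * DFT² A a b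
  DFT²-scale c A a b = begin
    DFT² (λ i j → c ℤ.* A i j) a b
      ≈⟨ DFT-cong a (λ i → trans (DFT-cong b (λ j → fromℤ-* c (A i j))) (DFT-scale (fromℤ c) (λ j → fromℤ (A i j)) b)) ⟩
    DFT (λ i → fromℤ c * DFT (λ j → fromℤ (A i j)) b) a
      ≈⟨ DFT-scale (fromℤ c) (λ i → DFT (λ j → fromℤ (A i j)) b) a ⟩
    fromℤ c * DFT² A a b ∎

  DFT²-compose : ∀ A B a b → DFT² (compose e A B) a b ≈ DFT² A a b * DFT² B a b
  DFT²-compose A B a b = begin
    DFT² (compose e A B) a b
      ≈⟨ DFT-cong a inner ⟩
    DFT (λ i → sum (λ s → DFT (λ t → fromℤ (A s t)) b * DFT (λ t → fromℤ (B (subMod e i s) t)) b)) a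
      ≈⟨ DFT-convolution (λ s → DFT (λ t → fromℤ (A s t)) b) (λ s → DFT (λ t → fromℤ (B s t)) b) a ⟩
    DFT² A a b * DFT² B a b ∎
    where
    entry : ∀ i j → fromℤ (compose e A B i j) ≈ sum (λ s → sum (λ t → fromℤ (A s t) * fromℤ (B (subMod e i s) (subMod e j t))))
    entry i j = trans (fromℤ-sumℤ (λ s → sumℤ (λ t → A s t ℤ.* B (subMod e i s) (subMod e j t))))
      (sum-cong (λ s → trans (fromℤ-sumℤ (λ t → A s t ℤ.* B (subMod e i s) (subMod e j t)))
        (sum-cong (λ t → fromℤ-* (A s t) (B (subMod e i s) (subMod e j t))))))
    inner : ∀ i → DFT (λ j → fromℤ (compose e A B i j)) b ≈ sum (λ s → DFT (λ t → fromℤ (A s t)) b * DFT (λ t → fromℤ (B (subMod e i s) t)) b)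
    inner i = begin
      DFT (λ j → fromℤ (compose e A B i j)) b
        ≈⟨ DFT-cong b (entry i) ⟩
      DFT (λ j → sum (λ s → sum (λ t → fromℤ (A s t) * fromℤ (B (subMod e i s) (subMod e j t))))) b
        ≈⟨ DFT-sum (λ s j → sum (λ t → fromℤ (A s t) * fromℤ (B (subMod e i s) (subMod e j t)))) b ⟩
      sum (λ s → DFT (λ j → sum (λ t → fromℤ (A s t) * fromℤ (B (subMod e i s) (subMod e j t)))) b)
        ≈⟨ sum-cong {e} (λ s → DFT-convolution (λ t → fromℤ (A s t)) (λ t → fromℤ (B (subMod e i s) t)) b) ⟩
      sum (λ s → DFT (λ t → fromℤ (A s t)) b * DFT (λ t → fromℤ (B (subMod e i s) t)) b) ∎

  -- The exponent is `suc k` because zero compositions already leave one factor A.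
  DFT²-foldCompose : ∀ A k a b → DFT² (foldCompose e A k) a b ≈ DFT² A a b ^ suc k
  DFT²-foldCompose A zero    a b = sym (*-identityʳ _)
  DFT²-foldCompose A (suc k) a b = trans (DFT²-compose A (foldCompose e A k) a b) (*-congˡ (DFT²-foldCompose A k a b))

-- Elementary algebra in a finite field.

module FieldProperties {q : ℕ} (F : FiniteFieldOn q) where
  open FiniteFieldOn F hiding (IsGenerator)

  fieldRing : CommutativeRing 0ℓ 0ℓ
  fieldRing = record { isCommutativeRing = isCommutativeRing }

  open CommutativeRing fieldRing public
    using (+-assoc; +-comm; *-assoc; *-comm; *-identityˡ; *-identityʳ; zeroˡ; zeroʳ; distribˡ;
           +-identityˡ; +-identityʳ; -‿inverseˡ; -‿inverseʳ)
  open RingSums fieldRing public using (-‿involutive; -1*x≈-x; x∙y⁻¹≈ε⇒x≈y; *-distribʳ--)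
  private module P = RingSums fieldRing
  open ≡.≡-Reasoning

  -- The bridge that carries the power laws of `RingSums`, taken at `fieldRing`, over to the field's
  -- own power operation.
  ^≡powR : ∀ x k → x ^ k ≡ powR fieldRing x k
  ^≡powR x zero    = ≡.refl
  ^≡powR x (suc k) = ≡.cong (x ⊗_) (^≡powR x k)

  ^-+ : ∀ x m n → x ^ (m ℕ.+ n) ≡ (x ^ m) ⊗ (x ^ n)
  ^-+ x m n rewrite ^≡powR x (m ℕ.+ n) | ^≡powR x m | ^≡powR x n = P.^-+ x m n

  ^-* : ∀ x m n → x ^ (m ℕ.* n) ≡ (x ^ m) ^ n
  ^-* x m n rewrite ^≡powR x (m ℕ.* n) | ^≡powR (x ^ m) n | ^≡powR x m = P.^-* x m n

  ⊗-^ : ∀ x y n → (x ⊗ y) ^ n ≡ (x ^ n) ⊗ (y ^ n)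
  ⊗-^ x y n rewrite ^≡powR (x ⊗ y) n | ^≡powR x n | ^≡powR y n = P.*-^ x y n

  𝟙^ : ∀ n → 𝟙 ^ n ≡ 𝟙
  𝟙^ n rewrite ^≡powR 𝟙 n = P.1^ n

  ^-comm : ∀ x m n → (x ^ m) ^ n ≡ (x ^ n) ^ m
  ^-comm x m n = ≡.trans (≡.sym (^-* x m n)) (≡.trans (≡.cong (x ^_) (ℕₚ.*-comm m n)) (^-* x n m))

  ⊗-cancelˡ : ∀ x {y z} → x ≢ 𝟘 → x ⊗ y ≡ x ⊗ z → y ≡ z
  ⊗-cancelˡ x {y} {z} x≢𝟘 xy≡xz = begin
    y                ≡⟨ *-identityˡ y ⟨
    𝟙 ⊗ y            ≡⟨ ≡.cong (_⊗ y) x⁻¹x ⟨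
    (x⁻¹ ⊗ x) ⊗ y    ≡⟨ *-assoc x⁻¹ x y ⟩
    x⁻¹ ⊗ (x ⊗ y)    ≡⟨ ≡.cong (x⁻¹ ⊗_) xy≡xz ⟩
    x⁻¹ ⊗ (x ⊗ z)    ≡⟨ *-assoc x⁻¹ x z ⟨
    (x⁻¹ ⊗ x) ⊗ z    ≡⟨ ≡.cong (_⊗ z) x⁻¹x ⟩
    𝟙 ⊗ z            ≡⟨ *-identityˡ z ⟩
    z                ∎
    where
    x⁻¹ = proj₁ (inverse x x≢𝟘)
    x⁻¹x : x⁻¹ ⊗ x ≡ 𝟙
    x⁻¹x = ≡.trans (*-comm x⁻¹ x) (proj₂ (inverse x x≢𝟘))

  x⊗y≡𝟘⇒y≡𝟘 : ∀ {x y} → x ≢ 𝟘 → x ⊗ y ≡ 𝟘 → y ≡ 𝟘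
  x⊗y≡𝟘⇒y≡𝟘 {x} x≢𝟘 xy≡𝟘 = ⊗-cancelˡ x x≢𝟘 (≡.trans xy≡𝟘 (≡.sym (zeroʳ x)))

  ⊗-nonzero : ∀ {x y} → x ≢ 𝟘 → y ≢ 𝟘 → x ⊗ y ≢ 𝟘
  ⊗-nonzero x≢𝟘 y≢𝟘 xy≡𝟘 = y≢𝟘 (x⊗y≡𝟘⇒y≡𝟘 x≢𝟘 xy≡𝟘)

  ^-nonzero : ∀ {x} k → x ≢ 𝟘 → x ^ k ≢ 𝟘
  ^-nonzero zero    x≢𝟘 = 𝟘≢𝟙 ∘ ≡.sym
  ^-nonzero (suc k) x≢𝟘 = ⊗-nonzero x≢𝟘 (^-nonzero k x≢𝟘)

  ⊖𝟙-square : (⊖ 𝟙) ⊗ (⊖ 𝟙) ≡ 𝟙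
  ⊖𝟙-square = ≡.trans (-1*x≈-x (⊖ 𝟙)) (-‿involutive 𝟙)

  ⊖𝟙≢𝟘 : ⊖ 𝟙 ≢ 𝟘
  ⊖𝟙≢𝟘 ⊖𝟙≡𝟘 = 𝟘≢𝟙 (≡.sym (≡.trans (≡.sym ⊖𝟙-square) (≡.trans (≡.cong (_⊗ (⊖ 𝟙)) ⊖𝟙≡𝟘) (zeroˡ (⊖ 𝟙)))))

  -- (x - 1)(x + 1) = 0 with a nonzero first factor.
  x²≡𝟙⇒x≡⊖𝟙 : ∀ {x} → x ⊗ x ≡ 𝟙 → x ≢ 𝟙 → x ≡ ⊖ 𝟙
  x²≡𝟙⇒x≡⊖𝟙 {x} x²≡𝟙 x≢𝟙 = x∙y⁻¹≈ε⇒x≈y x (⊖ 𝟙) (x⊗y≡𝟘⇒y≡𝟘 (λ x-1≡𝟘 → x≢𝟙 (x∙y⁻¹≈ε⇒x≈y x 𝟙 x-1≡𝟘)) (begin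
    (x ⊕ (⊖ 𝟙)) ⊗ (x ⊕ (⊖ (⊖ 𝟙)))         ≡⟨ ≡.cong (λ z → (x ⊕ (⊖ 𝟙)) ⊗ (x ⊕ z)) (-‿involutive 𝟙) ⟩
    (x ⊕ (⊖ 𝟙)) ⊗ (x ⊕ 𝟙)                 ≡⟨ *-distribʳ-- x 𝟙 (x ⊕ 𝟙) ⟩
    (x ⊗ (x ⊕ 𝟙)) ⊕ (⊖ (𝟙 ⊗ (x ⊕ 𝟙)))     ≡⟨ ≡.cong₂ (λ y z → y ⊕ (⊖ z)) x[x+1]≡x+1 (*-identityˡ (x ⊕ 𝟙)) ⟩
    (x ⊕ 𝟙) ⊕ (⊖ (x ⊕ 𝟙))                 ≡⟨ -‿inverseʳ (x ⊕ 𝟙) ⟩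
    𝟘                                     ∎))
    where
    x[x+1]≡x+1 : x ⊗ (x ⊕ 𝟙) ≡ x ⊕ 𝟙
    x[x+1]≡x+1 = begin
      x ⊗ (x ⊕ 𝟙)          ≡⟨ distribˡ x x 𝟙 ⟩
      (x ⊗ x) ⊕ (x ⊗ 𝟙)    ≡⟨ ≡.cong₂ _⊕_ x²≡𝟙 (*-identityʳ x) ⟩
      𝟙 ⊕ x                ≡⟨ +-comm 𝟙 x ⟩
      x ⊕ 𝟙                ∎

  ^-∸ : ∀ {x i j} → x ≢ 𝟘 → i ≤ j → x ^ i ≡ x ^ j → x ^ (j ∸ i) ≡ 𝟙
  ^-∸ {x} {i} {j} x≢𝟘 i≤j eq = ⊗-cancelˡ (x ^ i) (^-nonzero i x≢𝟘) (begin
    (x ^ i) ⊗ (x ^ (j ∸ i))    ≡⟨ ^-+ x i (j ∸ i) ⟨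
    x ^ (i ℕ.+ (j ∸ i))        ≡⟨ ≡.cong (x ^_) (ℕₚ.m+[n∸m]≡n i≤j) ⟩
    x ^ j                      ≡⟨ eq ⟨
    x ^ i                      ≡⟨ *-identityʳ (x ^ i) ⟨
    (x ^ i) ⊗ 𝟙                ∎)

  ^-% : ∀ {x} d .{{_ : NonZero d}} → x ^ d ≡ 𝟙 → ∀ k → x ^ (k % d) ≡ x ^ k
  ^-% {x} d x^d≡𝟙 k = ≡.sym (begin
    x ^ k                                ≡⟨ ≡.cong (x ^_) (m≡m%n+[m/n]*n k d) ⟩
    x ^ (k % d ℕ.+ k / d ℕ.* d)          ≡⟨ ^-+ x (k % d) (k / d ℕ.* d) ⟩
    (x ^ (k % d)) ⊗ (x ^ (k / d ℕ.* d))  ≡⟨ ≡.cong (λ n → (x ^ (k % d)) ⊗ (x ^ n)) (ℕₚ.*-comm (k / d) d) ⟩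
    (x ^ (k % d)) ⊗ (x ^ (d ℕ.* (k / d))) ≡⟨ ≡.cong ((x ^ (k % d)) ⊗_) (≡.trans (^-* x d (k / d)) (≡.trans (≡.cong (_^ (k / d)) x^d≡𝟙) (𝟙^ (k / d)))) ⟩
    (x ^ (k % d)) ⊗ 𝟙                    ≡⟨ *-identityʳ _ ⟩
    x ^ (k % d)                          ∎)

  -- Made total by sending 𝟘 to itself: it is then an involution of the whole field and can reindex
  -- sums over it.
  inv : Fin q → Fin q
  inv x with x Fin.≟ 𝟘
  ... | yes _   = 𝟘
  ... | no x≢𝟘 = proj₁ (inverse x x≢𝟘)

  inv-𝟘 : ∀ {x} → x ≡ 𝟘 → inv x ≡ 𝟘
  inv-𝟘 {x} x≡𝟘 with x Fin.≟ 𝟘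
  ... | yes _   = ≡.refl
  ... | no x≢𝟘 = contradiction x≡𝟘 x≢𝟘

  x⊗inv : ∀ {x} → x ≢ 𝟘 → x ⊗ inv x ≡ 𝟙
  x⊗inv {x} x≢𝟘 with x Fin.≟ 𝟘
  ... | yes x≡𝟘 = contradiction x≡𝟘 x≢𝟘
  ... | no x≢𝟘′ = proj₂ (inverse x x≢𝟘′)

  inv-nonzero : ∀ {x} → x ≢ 𝟘 → inv x ≢ 𝟘
  inv-nonzero {x} x≢𝟘 eq = 𝟘≢𝟙 (≡.trans (≡.sym (≡.trans (≡.cong (x ⊗_) eq) (zeroʳ x))) (x⊗inv x≢𝟘))

  inv-involutive : ∀ x → inv (inv x) ≡ x
  inv-involutive x with x Fin.≟ 𝟘 in eq
  ... | yes x≡𝟘 = ≡.trans (inv-𝟘 ≡.refl) (≡.sym x≡𝟘)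
  ... | no x≢𝟘 = ⊗-cancelˡ y y≢𝟘 (≡.trans (x⊗inv y≢𝟘) (≡.trans (≡.sym xy≡𝟙) (*-comm x y)))
    where
    y = proj₁ (inverse x x≢𝟘)
    xy≡𝟙 : x ⊗ y ≡ 𝟙
    xy≡𝟙 = proj₂ (inverse x x≢𝟘)
    y≢𝟘 : y ≢ 𝟘
    y≢𝟘 y≡𝟘 = 𝟘≢𝟙 (≡.trans (≡.sym (≡.trans (≡.cong (x ⊗_) y≡𝟘) (zeroʳ x))) xy≡𝟙)

-- The order of a generator and the enumeration of the field by its powers.

Fin1-unique : ∀ (x y : Fin 1) → x ≡ y
Fin1-unique zero zero = ≡.refl

module _ {m : ℕ} (F : FiniteFieldOn (suc m)) {g : Fin (suc m)} (gen : IsGenerator F g) where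
  open FiniteFieldOn F hiding (IsGenerator)
  open FieldProperties F

  private
    g≢𝟘 = proj₁ gen

    -- If g^d = 1, an exponent mod d determines a nonzero element; with one more code for 𝟘 the
    -- field embeds into d + 1 codes. The same map at d = m is the logarithm used to enumerate the
    -- field.
    reducedLog : ∀ d .{{_ : NonZero d}} → Fin (suc m) → Fin (suc d)
    reducedLog d α with α Fin.≟ 𝟘
    ... | yes _   = zero
    ... | no α≢𝟘 = suc (proj₁ (proj₂ gen α α≢𝟘) mod d)

    reducedLog-injective : ∀ d .{{_ : NonZero d}} → g ^ d ≡ 𝟙 → ∀ {α β} → reducedLog d α ≡ reducedLog d β → α ≡ β
    reducedLog-injective d g^d≡𝟙 {α} {β} eq with α Fin.≟ 𝟘 | β Fin.≟ 𝟘
    ... | yes α≡𝟘 | yes β≡𝟘 = ≡.trans α≡𝟘 (≡.sym β≡𝟘)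
    ... | yes _    | no _     = contradiction eq λ ()
    ... | no _     | yes _    = contradiction eq λ ()
    ... | no α≢𝟘  | no β≢𝟘  with proj₂ gen α α≢𝟘 | proj₂ gen β β≢𝟘
    ...   | k , ≡.refl | l , ≡.refl = begin
      g ^ k          ≡⟨ ^-% d g^d≡𝟙 k ⟨
      g ^ (k % d)    ≡⟨ ≡.cong (g ^_) k%d≡l%d ⟩
      g ^ (l % d)    ≡⟨ ^-% d g^d≡𝟙 l ⟩
      g ^ l          ∎
      where
      open ≡.≡-Reasoning
      k%d≡l%d : k % d ≡ l % d
      k%d≡l%d = begin
        k % d            ≡⟨ Finₚ.toℕ-fromℕ< (m%n<n k d) ⟨
        toℕ (k mod d)    ≡⟨ ≡.cong toℕ (Finₚ.suc-injective eq) ⟩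
        toℕ (l mod d)    ≡⟨ Finₚ.toℕ-fromℕ< (m%n<n l d) ⟩
        l % d            ∎

  -- The m + 1 field elements embed into d + 1 codes.
  order-minimal′ : ∀ d .{{_ : NonZero d}} → g ^ d ≡ 𝟙 → m ≤ d
  order-minimal′ d g^d≡𝟙 = ℕₚ.≤-pred (Finₚ.injective⇒≤ (reducedLog-injective d g^d≡𝟙))

  private
    𝟘≢g^ : ∀ {n} (i : Fin n) → 𝟘 ≢ g ^ toℕ i
    𝟘≢g^ i = ^-nonzero (toℕ i) g≢𝟘 ∘ ≡.sym

  -- The m + 1 powers g^0, ..., g^m avoid 𝟘, and only m values remain, so two of them agree. Their
  -- exponents differ by at most m, and by at least m because of `order-minimal′`.
  generator-order′ : g ^ m ≡ 𝟙
  generator-order′ with Finₚ.pigeonhole (ℕₚ.n<1+n m) (λ i → Fin.punchOut (𝟘≢g^ i))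
  ... | i , j , i<j , eq = ≡.subst (λ d → g ^ d ≡ 𝟙) d≡m g^d≡𝟙
    where
    d = toℕ j ∸ toℕ i
    g^d≡𝟙 : g ^ d ≡ 𝟙
    g^d≡𝟙 = ^-∸ g≢𝟘 (ℕₚ.<⇒≤ i<j) (Finₚ.punchOut-injective (𝟘≢g^ i) (𝟘≢g^ j) eq)
    d≡m : d ≡ m
    d≡m = ℕₚ.≤-antisym (ℕₚ.≤-trans (ℕₚ.m∸n≤m (toℕ j) (toℕ i)) (Finₚ.toℕ≤pred[n] j))
                       (order-minimal′ d {{ℕ.>-nonZero (ℕₚ.m<n⇒0<n∸m i<j)}} g^d≡𝟙)

  ^-injective-< : ∀ {i j} → i < j → j < m → g ^ i ≢ g ^ j
  ^-injective-< {i} {j} i<j j<m eq = ℕₚ.<-irrefl ≡.refl (begin-strict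
    m        ≤⟨ order-minimal′ (j ∸ i) {{ℕ.>-nonZero (ℕₚ.m<n⇒0<n∸m i<j)}} (^-∸ g≢𝟘 (ℕₚ.<⇒≤ i<j) eq) ⟩
    j ∸ i    ≤⟨ ℕₚ.m∸n≤m j i ⟩
    j        <⟨ j<m ⟩
    m        ∎)
    where open ℕₚ.≤-Reasoning

  ^-injective : ∀ {i j} → i < m → j < m → g ^ i ≡ g ^ j → i ≡ j
  ^-injective {i} {j} i<m j<m eq with ℕₚ.<-cmp i j
  ... | tri< i<j _ _ = contradiction eq (^-injective-< i<j j<m)
  ... | tri≈ _ i≡j _ = i≡j
  ... | tri> _ _ j<i = contradiction (≡.sym eq) (^-injective-< j<i i<m)

  module _ (R : CommutativeRing 0ℓ 0ℓ) where
    open CommutativeRing R using (Carrier; _≈_; _+_)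
    open RingSums R using (sum; ∑<; sum-permute)

    -- `exp` lists 𝟘 first, so the reindexed sum unfolds to the right-hand side. `log` is a right
    -- inverse of `exp`, and injectivity of `exp` makes it a left inverse too.
    sum-generator′ : ∀ (f : Fin (suc m) → Carrier) → sum f ≈ f 𝟘 + ∑< m (λ k → f (g ^ k))
    sum-generator′ f = sum-permute f (permutation exp log exp-log log-exp)
      where
      instance _ : NonZero m
               _ = ℕ.≢-nonZero λ { ≡.refl → 𝟘≢𝟙 (Fin1-unique 𝟘 𝟙) }
      exp : Fin (suc m) → Fin (suc m)
      exp zero    = 𝟘
      exp (suc k) = g ^ toℕ k
      log : Fin (suc m) → Fin (suc m)
      log = reducedLog m
      exp-log : ∀ α → exp (log α) ≡ α
      exp-log α with α Fin.≟ 𝟘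
      ... | yes α≡𝟘 = ≡.sym α≡𝟘
      ... | no α≢𝟘 with proj₂ gen α α≢𝟘
      ...   | k , g^k≡α = ≡.trans (≡.cong (g ^_) (Finₚ.toℕ-fromℕ< (m%n<n k m)))
                                  (≡.trans (^-% m generator-order′ k) g^k≡α)
      log-exp : ∀ i → log (exp i) ≡ i
      log-exp i = exp-injective (log (exp i)) i (exp-log (exp i))
        where
        exp-injective : ∀ i j → exp i ≡ exp j → i ≡ j
        exp-injective zero    zero    eq = ≡.refl
        exp-injective zero    (suc j) eq = contradiction (≡.sym eq) (^-nonzero (toℕ j) g≢𝟘)
        exp-injective (suc i) zero    eq = contradiction eq (^-nonzero (toℕ i) g≢𝟘)
        exp-injective (suc i) (suc j) eq = ≡.cong suc (Finₚ.toℕ-injective (^-injective (Finₚ.toℕ<n i) (Finₚ.toℕ<n j) eq))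

-- Here q is arbitrary, as a power of p is not visibly a successor. Each `go` generalises over it to
-- allow the case split; order 0 is impossible because 𝟘 exists.
module Generator {q : ℕ} (F : FiniteFieldOn q) {g : Fin q} (gen : IsGenerator F g) where
  open FiniteFieldOn F hiding (IsGenerator)
  open FieldProperties F

  generator-order : g ^ (q ∸ 1) ≡ 𝟙
  generator-order = go F gen
    where
    go : ∀ {q} (F : FiniteFieldOn q) {g} → IsGenerator F g → FiniteFieldOn._^_ F g (q ∸ 1) ≡ FiniteFieldOn.𝟙 F
    go {zero}  F gen = contradiction (FiniteFieldOn.𝟘 F) Finₚ.¬Fin0
    go {suc m} F gen = generator-order′ F gen

  order-minimal : ∀ d .{{_ : NonZero d}} → g ^ d ≡ 𝟙 → q ∸ 1 ≤ d
  order-minimal d = go F gen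
    where
    go : ∀ {q} (F : FiniteFieldOn q) {g} → IsGenerator F g → FiniteFieldOn._^_ F g d ≡ FiniteFieldOn.𝟙 F → q ∸ 1 ≤ d
    go {zero}  F gen = contradiction (FiniteFieldOn.𝟘 F) Finₚ.¬Fin0
    go {suc m} F gen = order-minimal′ F gen d

  module _ (R : CommutativeRing 0ℓ 0ℓ) where
    open CommutativeRing R using (Carrier; _≈_; _+_)
    open RingSums R using (sum; ∑<)

    sum-generator : ∀ (f : Fin q → Carrier) → sum f ≈ f 𝟘 + ∑< (q ∸ 1) (λ k → f (g ^ k))
    sum-generator = go F gen
      where
      go : ∀ {q} (F : FiniteFieldOn q) {g} → IsGenerator F g → ∀ (f : Fin q → Carrier) →
           sum f ≈ f (FiniteFieldOn.𝟘 F) + ∑< (q ∸ 1) (λ k → f (FiniteFieldOn._^_ F g k))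
      go {zero}  F gen = contradiction (FiniteFieldOn.𝟘 F) Finₚ.¬Fin0
      go {suc m} F gen = sum-generator′ F gen R

  nonzero^[q-1] : ∀ {x} → x ≢ 𝟘 → x ^ (q ∸ 1) ≡ 𝟙
  nonzero^[q-1] x≢𝟘 with proj₂ gen _ x≢𝟘
  ... | k , ≡.refl = ≡.trans (^-comm g k (q ∸ 1)) (≡.trans (≡.cong (_^ k) generator-order) (𝟙^ k))

  1≤q-1 : 1 ≤ q ∸ 1
  1≤q-1 = go F
    where
    go : ∀ {q} → FiniteFieldOn q → 1 ≤ q ∸ 1
    go {zero}        F = contradiction (FiniteFieldOn.𝟘 F) Finₚ.¬Fin0
    go {suc zero}    F = contradiction (Fin1-unique (FiniteFieldOn.𝟘 F) (FiniteFieldOn.𝟙 F)) (FiniteFieldOn.𝟘≢𝟙 F)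
    go {suc (suc m)} F = s≤s z≤n

  -- The power of -1 with exponent q - 1 is 1, but for an odd exponent it is also -1.
  𝟙≡⊖𝟙-odd : ∀ h → q ∸ 1 ≡ suc (h ℕ.+ h) → 𝟙 ≡ ⊖ 𝟙
  𝟙≡⊖𝟙-odd h eq = begin
    𝟙                                    ≡⟨ nonzero^[q-1] ⊖𝟙≢𝟘 ⟨
    (⊖ 𝟙) ^ (q ∸ 1)                      ≡⟨ ≡.cong ((⊖ 𝟙) ^_) eq ⟩
    (⊖ 𝟙) ⊗ ((⊖ 𝟙) ^ (h ℕ.+ h))          ≡⟨ ≡.cong ((⊖ 𝟙) ⊗_) (≡.trans (^-+ (⊖ 𝟙) h h) (≡.sym (⊗-^ (⊖ 𝟙) (⊖ 𝟙) h))) ⟩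
    (⊖ 𝟙) ⊗ (((⊖ 𝟙) ⊗ (⊖ 𝟙)) ^ h)        ≡⟨ ≡.cong ((⊖ 𝟙) ⊗_) (≡.trans (≡.cong (_^ h) ⊖𝟙-square) (𝟙^ h)) ⟩
    (⊖ 𝟙) ⊗ 𝟙                            ≡⟨ *-identityʳ (⊖ 𝟙) ⟩
    ⊖ 𝟙                                  ∎
    where open ≡.≡-Reasoning

  -- g^h squares to 1 and differs from 1, since 0 < h is below the order 2h.
  g^h≡⊖𝟙-even : ∀ h → q ∸ 1 ≡ h ℕ.+ h → g ^ h ≡ ⊖ 𝟙
  g^h≡⊖𝟙-even zero    eq = contradiction (≡.subst (1 ≤_) eq 1≤q-1) λ ()
  g^h≡⊖𝟙-even h@(suc _) eq = x²≡𝟙⇒x≡⊖𝟙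
    (≡.trans (≡.sym (^-+ g h h)) (≡.trans (≡.cong (g ^_) (≡.sym eq)) generator-order))
    (λ g^h≡𝟙 → ℕₚ.m+1+n≰m h (≡.subst (_≤ h) eq (order-minimal h g^h≡𝟙)))

-- Parity of q - 1 and the discrete logarithm of -1.

-- The parity is that of the order q - 1 of the unit group, not of q: `OddOrder` is the case p = 2.
OddOrder EvenOrder : ℕ → Set
OddOrder  q = ∃[ h ] q ∸ 1 ≡ suc (h ℕ.+ h)
EvenOrder q = ∃[ h ] q ∸ 1 ≡ h ℕ.+ h

n%2 : ∀ n → n % 2 ≡ 0 ⊎ n % 2 ≡ 1
n%2 n with n % 2 | m%n<n n 2
... | 0 | _ = inj₁ ≡.refl
... | 1 | _ = inj₂ ≡.refl
... | suc (suc _) | s≤s (s≤s ())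

m*2≡m+m : ∀ m → m ℕ.* 2 ≡ m ℕ.+ m
m*2≡m+m m = ≡.trans (ℕₚ.*-comm m 2) (≡.cong (m ℕ.+_) (ℕₚ.+-identityʳ m))

2∤⇒odd : ∀ n → 2 ∤ n → n ≡ suc (n / 2 ℕ.+ n / 2)
2∤⇒odd n 2∤n with n%2 n
... | inj₁ n%2≡0 = contradiction (m%n≡0⇒n∣m n 2 n%2≡0) 2∤n
... | inj₂ n%2≡1 = ≡.trans (m≡m%n+[m/n]*n n 2) (≡.cong₂ ℕ._+_ n%2≡1 (m*2≡m+m (n / 2)))

2∣2^ : ∀ r → 1 ≤ r → 2 ∣ 2 ℕ.^ r
2∣2^ (suc r) _ = m∣m*n (2 ℕ.^ r)

2^r-odd : ∀ r → 1 ≤ r → OddOrder (2 ℕ.^ r)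
2^r-odd r 1≤r with 2∣2^ r 1≤r | ℕₚ.m^n>0 2 r
... | divides zero    2^r≡ | 0<2^r = contradiction (≡.subst (0 <_) 2^r≡ 0<2^r) λ ()
... | divides (suc h) 2^r≡ | _     = h , ≡.trans (≡.cong (_∸ 1) 2^r≡) (≡.cong suc (m*2≡m+m h))

2∤p^r : ∀ {p} → Prime p → p ≢ 2 → ∀ r → 2 ∤ p ℕ.^ r
2∤p^r pp p≢2 zero    2∣1 = contradiction (∣1⇒≡1 2∣1) λ ()
2∤p^r {p} pp p≢2 (suc r) 2∣ with euclidsLemma p (p ℕ.^ r) prime[2] 2∣
... | inj₂ 2∣p^r = 2∤p^r pp p≢2 r 2∣p^r
... | inj₁ 2∣p with prime⇒irreducible pp 2∣p
...   | inj₁ ()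
...   | inj₂ 2≡p = p≢2 (≡.sym 2≡p)

p^r-even : ∀ {p} → Prime p → p ≢ 2 → ∀ r → EvenOrder (p ℕ.^ r)
p^r-even {p} pp p≢2 r = p ℕ.^ r / 2 , ≡.cong (_∸ 1) (2∤⇒odd (p ℕ.^ r) (2∤p^r pp p≢2 r))

-- Induction by q^(n+1) - 1 = q^n (q - 1) + (q^n - 1).
q-1∣q^n-1 : ∀ q n → 1 ≤ q → (q ∸ 1) ∣ (q ℕ.^ n ∸ 1)
q-1∣q^n-1 (suc m) zero    _ = divides 0 ≡.refl
q-1∣q^n-1 (suc m) (suc n) _ with q-1∣q^n-1 (suc m) n (s≤s z≤n)
... | divides k eq = divides (suc m ℕ.^ n ℕ.+ k) (begin
  suc m ℕ.* Q ∸ 1            ≡⟨ ≡.cong (_∸ 1) (ℕₚ.+-comm Q (m ℕ.* Q)) ⟩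
  m ℕ.* Q ℕ.+ Q ∸ 1          ≡⟨ ℕₚ.+-∸-assoc (m ℕ.* Q) (ℕₚ.m^n>0 (suc m) n) ⟩
  m ℕ.* Q ℕ.+ (Q ∸ 1)        ≡⟨ ≡.cong₂ ℕ._+_ (ℕₚ.*-comm m Q) eq ⟩
  Q ℕ.* m ℕ.+ k ℕ.* m        ≡⟨ ℕₚ.*-distribʳ-+ m Q k ⟨
  (Q ℕ.+ k) ℕ.* m            ∎)
  where
  open ≡.≡-Reasoning
  Q = suc m ℕ.^ n

⌊toℕ≟⌋ : ∀ {e k} (i c : Fin e) → toℕ c ≡ k → ⌊ toℕ i ℕ.≟ k ⌋ ≡ ⌊ i Fin.≟ c ⌋
⌊toℕ≟⌋ i c ≡.refl with toℕ i ℕ.≟ toℕ c | i Fin.≟ c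
... | yes _  | yes _  = ≡.refl
... | no _   | no _   = ≡.refl
... | yes eq | no i≢c = contradiction (Finₚ.toℕ-injective eq) i≢c
... | no neq | yes eq = contradiction (≡.cong toℕ eq) neq

module _ {q : ℕ} (F : FiniteFieldOn q) {g : Fin q} (gen : IsGenerator F g)
         (p e : ℕ) .{{_ : NonZero e}} (2≤e : 2 ≤ e) (e∣q-1 : e ∣ q ∸ 1)
         (odd : p ≡ 2 → OddOrder q) (even : p ≢ 2 → EvenOrder q) where
  open FiniteFieldOn F hiding (IsGenerator)
  open FieldProperties F
  open Generator F gen

  private
    f = (q ∸ 1) / e
    c₀ : Fin e
    c₀ = fromℕ< (ℕ.>-nonZero⁻¹ e)

    +c₀ : ∀ k → k ℕ.+ toℕ c₀ ≡ k
    +c₀ k = ≡.trans (≡.cong (k ℕ.+_) (Finₚ.toℕ-fromℕ< _)) (ℕₚ.+-identityʳ k)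

    char-2 : p ≡ 2 → g ^ (e ℕ.* 0 ℕ.+ toℕ c₀) ≡ ⊖ 𝟙
    char-2 p≡2 with odd p≡2
    ... | h , q-1≡ = ≡.trans (≡.cong (g ^_) (≡.trans (+c₀ (e ℕ.* 0)) (ℕₚ.*-zeroʳ e))) (𝟙≡⊖𝟙-odd h q-1≡)

    indicator : ∀ {k} (c : Fin e) → toℕ c ≡ k → ∀ i → (if ⌊ toℕ i ℕ.≟ k ⌋ then 1 else 0) ≡ (if ⌊ i Fin.≟ c ⌋ then 1 else 0)
    indicator c c≡k i = ≡.cong (λ b → if b then 1 else 0) (⌊toℕ≟⌋ i c c≡k)

  -- Dδ is the indicator of the residue mod e of the discrete logarithm of −1.
  Dδ-indicator : ∃[ c ] ∃[ v ] (g ^ (e ℕ.* v ℕ.+ toℕ c) ≡ ⊖ 𝟙) × (∀ i → Dδ p q e i ≡ (if ⌊ i Fin.≟ c ⌋ then 1 else 0))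
  Dδ-indicator with f % 2 ℕ.≟ 0 | p ℕ.≟ 2
  ... | yes _ | yes p≡2 = c₀ , 0 , char-2 p≡2 , indicator c₀ (Finₚ.toℕ-fromℕ< _)
  ... | no _  | yes p≡2 = c₀ , 0 , char-2 p≡2 , indicator c₀ (Finₚ.toℕ-fromℕ< _)
  ... | yes f%2≡0 | no p≢2 = c₀ , f / 2 , ≡.trans (≡.cong (g ^_) (+c₀ (e ℕ.* (f / 2)))) (g^h≡⊖𝟙-even (e ℕ.* (f / 2)) (begin
        q ∸ 1                                          ≡⟨ m*[n/m]≡n e∣q-1 ⟨
        e ℕ.* f                                        ≡⟨ ≡.cong (e ℕ.*_) (≡.trans (m≡m%n+[m/n]*n f 2) (≡.cong₂ ℕ._+_ f%2≡0 (m*2≡m+m (f / 2)))) ⟩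
        e ℕ.* (f / 2 ℕ.+ f / 2)                        ≡⟨ ℕₚ.*-distribˡ-+ e (f / 2) (f / 2) ⟩
        e ℕ.* (f / 2) ℕ.+ e ℕ.* (f / 2)                ∎))
      , indicator c₀ (Finₚ.toℕ-fromℕ< _)
    where open ≡.≡-Reasoning
  ... | no f%2≢0 | no p≢2 = c , f / 2 , ≡.trans (≡.cong (g ^_) exponent) (g^h≡⊖𝟙-even h q-1≡h+h)
      , indicator c (Finₚ.toℕ-fromℕ< _)
    where
    open ≡.≡-Reasoning
    instance _ : NonZero e
             _ = ℕ.>-nonZero (ℕₚ.≤-trans (s≤s z≤n) 2≤e)
    c : Fin e
    c = fromℕ< (m/n<m e 2 (s≤s (s≤s z≤n)))
    h = proj₁ (even p≢2)
    q-1≡h+h = proj₂ (even p≢2)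
    f-odd : f ≡ suc (f / 2 ℕ.+ f / 2)
    f-odd = 2∤⇒odd f (f%2≢0 ∘ n∣m⇒m%n≡0 f 2)
    -- The product e f = q - 1 is even and f is odd; hence `e / 2` is exact.
    2∣e : 2 ∣ e
    2∣e with euclidsLemma e f prime[2] (divides h (≡.trans (m*[n/m]≡n e∣q-1) (≡.trans q-1≡h+h (≡.sym (m*2≡m+m h)))))
    ... | inj₁ 2∣e = 2∣e
    ... | inj₂ 2∣f = contradiction (n∣m⇒m%n≡0 f 2 2∣f) f%2≢0
    e′ = e / 2
    e≡e′+e′ : e ≡ e′ ℕ.+ e′
    e≡e′+e′ = ≡.trans (≡.sym (m*[n/m]≡n 2∣e)) (≡.cong (e′ ℕ.+_) (ℕₚ.+-identityʳ e′))
    -- Half of q - 1 = e f for odd f, written as quotient and remainder by e: the remainder is e/2,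
    -- the index prescribed by D.
    k = e ℕ.* (f / 2) ℕ.+ e′
    doubled : k ℕ.+ k ≡ h ℕ.+ h
    doubled = begin
      k ℕ.+ k                                                   ≡⟨ interchange (e ℕ.* (f / 2)) e′ (e ℕ.* (f / 2)) e′ ⟩
      (e ℕ.* (f / 2) ℕ.+ e ℕ.* (f / 2)) ℕ.+ (e′ ℕ.+ e′)          ≡⟨ ≡.cong₂ ℕ._+_ (ℕₚ.*-distribˡ-+ e (f / 2) (f / 2)) e≡e′+e′ ⟨
      e ℕ.* (f / 2 ℕ.+ f / 2) ℕ.+ e                             ≡⟨ ℕₚ.+-comm _ e ⟩
      e ℕ.+ e ℕ.* (f / 2 ℕ.+ f / 2)                             ≡⟨ ℕₚ.*-suc e _ ⟨
      e ℕ.* suc (f / 2 ℕ.+ f / 2)                               ≡⟨ ≡.cong (e ℕ.*_) f-odd ⟨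
      e ℕ.* f                                                   ≡⟨ m*[n/m]≡n e∣q-1 ⟩
      q ∸ 1                                                     ≡⟨ q-1≡h+h ⟩
      h ℕ.+ h                                                   ∎
      where open import Algebra.Properties.CommutativeSemigroup ℕₚ.+-commutativeSemigroup using (interchange)
    exponent : e ℕ.* (f / 2) ℕ.+ toℕ c ≡ h
    exponent = ≡.trans (≡.cong (e ℕ.* (f / 2) ℕ.+_) (Finₚ.toℕ-fromℕ< _))
      (ℕₚ.*-cancelˡ-≡ k h 2 (≡.trans (≡.cong (k ℕ.+_) (ℕₚ.+-identityʳ k)) (≡.trans doubled (≡.cong (h ℕ.+_) (≡.sym (ℕₚ.+-identityʳ h))))))

-- Character sums and the transform of the multiplication matrix.

⌊≟⌋-sym : ∀ {n} (x y : Fin n) → ⌊ x Fin.≟ y ⌋ ≡ ⌊ y Fin.≟ x ⌋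
⌊≟⌋-sym x y with x Fin.≟ y | y Fin.≟ x
... | yes _   | yes _   = ≡.refl
... | no _    | no _    = ≡.refl
... | yes x≡y | no y≢x  = contradiction (≡.sym x≡y) y≢x
... | no x≢y  | yes y≡x = contradiction (≡.sym y≡x) x≢y

-- `ψ` is a parameter so that the results apply both to χᵃ on the small field and to χᵃ ∘ Nr on the
-- large one. Its two hypotheses fix all its values, since every nonzero element is a power of g.
module CharacterSums
  (R : CommutativeRing 0ℓ 0ℓ) (domain : IsCharZeroDomain R)
  (e : ℕ) .{{_ : NonZero e}} (ζ : CommutativeRing.Carrier R) (ζ-prim : IsPrimitiveRoot R e ζ)
  {q : ℕ} (F : FiniteFieldOn q) {g : Fin q} (gen : IsGenerator F g) (e∣q-1 : e ∣ q ∸ 1)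
  (ψ : ℕ → Fin q → CommutativeRing.Carrier R)
  (ψ-𝟘 : ∀ a → CommutativeRing._≈_ R (ψ a (FiniteFieldOn.𝟘 F)) (CommutativeRing.0# R))
  (ψ-g^ : ∀ a k → CommutativeRing._≈_ R (ψ a (FiniteFieldOn._^_ F g k)) (powR R ζ (a ℕ.* k)))
  where
  open CommutativeRing R hiding (zero)
  open RingSums R hiding (_^_)
  open Fourier R domain e ζ ζ-prim
  open FiniteFieldOn F hiding (IsGenerator)
  private
    module 𝔽 = FieldProperties F
    module R^ = RingSums R
  open Generator F gen
  open import Relation.Binary.Reasoning.Setoid setoid

  private
    infixr 8 ζ^_
    ζ^_ : ℕ → Carrier
    ζ^ k = powR R ζ k

    q≡1+[q-1] : q ≡ suc (q ∸ 1)
    q≡1+[q-1] = ≡.sym (ℕₚ.m+[n∸m]≡n (ℕₚ.≤-trans 1≤q-1 (ℕₚ.m∸n≤m q 1)))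

  data Classified : Fin q → Set where
    isZero′ : Classified 𝟘
    power   : ∀ k → Classified (g ^ k)

  classify : ∀ x → Classified x
  classify x with x Fin.≟ 𝟘
  ... | yes ≡.refl = isZero′
  ... | no x≢𝟘 with proj₂ gen x x≢𝟘
  ...   | k , ≡.refl = power k

  ψ-≡𝟘 : ∀ a {x} → x ≡ 𝟘 → ψ a x ≈ 0#
  ψ-≡𝟘 a ≡.refl = ψ-𝟘 a

  ψ-⊗ : ∀ a x y → ψ a (x ⊗ y) ≈ ψ a x * ψ a y
  ψ-⊗ a x y with classify x | classify y
  ... | isZero′ | _       = trans (ψ-≡𝟘 a (𝔽.zeroˡ y)) (sym (trans (*-congʳ (ψ-𝟘 a)) (zeroˡ _)))
  ... | power k | isZero′ = trans (ψ-≡𝟘 a (𝔽.zeroʳ x)) (sym (trans (*-congˡ (ψ-𝟘 a)) (zeroʳ _)))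
  ... | power k | power l = begin
    ψ a ((g ^ k) ⊗ (g ^ l))          ≡⟨ ≡.cong (ψ a) (𝔽.^-+ g k l) ⟨
    ψ a (g ^ (k ℕ.+ l))              ≈⟨ ψ-g^ a (k ℕ.+ l) ⟩
    ζ^ (a ℕ.* (k ℕ.+ l))             ≡⟨ ≡.cong ζ^_ (ℕₚ.*-distribˡ-+ a k l) ⟩
    ζ^ (a ℕ.* k ℕ.+ a ℕ.* l)         ≈⟨ R^.^-+ ζ (a ℕ.* k) (a ℕ.* l) ⟩
    ζ^ (a ℕ.* k) * ζ^ (a ℕ.* l)      ≈⟨ *-cong (ψ-g^ a k) (ψ-g^ a l) ⟨
    ψ a (g ^ k) * ψ a (g ^ l)        ∎

  ψ-+ : ∀ a b x → ψ (a ℕ.+ b) x ≈ ψ a x * ψ b x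
  ψ-+ a b x with classify x
  ... | isZero′ = trans (ψ-𝟘 (a ℕ.+ b)) (sym (trans (*-congʳ (ψ-𝟘 a)) (zeroˡ _)))
  ... | power k = begin
    ψ (a ℕ.+ b) (g ^ k)              ≈⟨ ψ-g^ (a ℕ.+ b) k ⟩
    ζ^ ((a ℕ.+ b) ℕ.* k)             ≡⟨ ≡.cong ζ^_ (ℕₚ.*-distribʳ-+ k a b) ⟩
    ζ^ (a ℕ.* k ℕ.+ b ℕ.* k)         ≈⟨ R^.^-+ ζ (a ℕ.* k) (b ℕ.* k) ⟩
    ζ^ (a ℕ.* k) * ζ^ (b ℕ.* k)      ≈⟨ *-cong (ψ-g^ a k) (ψ-g^ b k) ⟨
    ψ a (g ^ k) * ψ b (g ^ k)        ∎

  ψ-trivial : ∀ {a x} → e ∣ a → x ≢ 𝟘 → ψ a x ≈ 1#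
  ψ-trivial {a} {x} e∣a x≢𝟘 with classify x
  ... | isZero′ = contradiction ≡.refl x≢𝟘
  ... | power k = trans (ψ-g^ a k) (e∣k⇒ζ^k≈1 (∣m⇒∣m*n k e∣a))

  ψ-𝟙 : ∀ a → ψ a 𝟙 ≈ 1#
  ψ-𝟙 a = trans (ψ-g^ a 0) (reflexive (≡.cong ζ^_ (ℕₚ.*-zeroʳ a)))

  ψ⊖𝟙² : ∀ a → ψ a (⊖ 𝟙) * ψ a (⊖ 𝟙) ≈ 1#
  ψ⊖𝟙² a = begin
    ψ a (⊖ 𝟙) * ψ a (⊖ 𝟙)      ≈⟨ ψ-⊗ a (⊖ 𝟙) (⊖ 𝟙) ⟨
    ψ a ((⊖ 𝟙) ⊗ (⊖ 𝟙))        ≡⟨ ≡.cong (ψ a) 𝔽.⊖𝟙-square ⟩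
    ψ a 𝟙                      ≈⟨ ψ-𝟙 a ⟩
    1#                         ∎

  sum-ψ : ∀ a → sum (ψ a) ≈ ∑< (q ∸ 1) (powR R (ζ^ a))
  sum-ψ a = begin
    sum (ψ a)                                    ≈⟨ sum-generator R (ψ a) ⟩
    ψ a 𝟘 + ∑< (q ∸ 1) (λ k → ψ a (g ^ k))       ≈⟨ +-cong (ψ-𝟘 a) (sum-cong {q ∸ 1} (λ k → trans (ψ-g^ a (toℕ k)) (R^.^-* ζ a (toℕ k)))) ⟩
    0# + ∑< (q ∸ 1) (powR R (ζ^ a))              ≈⟨ +-identityˡ _ ⟩
    ∑< (q ∸ 1) (powR R (ζ^ a))                   ∎

  sum-ψ-trivial : ∀ {a} → e ∣ a → sum (ψ a) ≈ fromℕ (q ∸ 1)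
  sum-ψ-trivial {a} e∣a = trans (sum-ψ a) (∑<-one (q ∸ 1) (e∣k⇒ζ^k≈1 e∣a))

  sum-ψ-nontrivial : ∀ {a} → e ∤ a → sum (ψ a) ≈ 0#
  sum-ψ-nontrivial {a} e∤a = trans (sum-ψ a)
    (∑<-root (q ∸ 1) (trans (sym (R^.^-* ζ a (q ∸ 1))) (e∣k⇒ζ^k≈1 (∣n⇒∣m*n a e∣q-1))) (e∤a ∘ ζ^k≈1⇒e∣k a))

  sum-⊖ : ∀ f → sum (λ α → f (⊖ α)) ≈ sum f
  sum-⊖ f = sym (sum-permute f (permutation ⊖_ ⊖_ 𝔽.-‿involutive 𝔽.-‿involutive))

  sum-inv : ∀ f → sum (λ α → f (𝔽.inv α)) ≈ sum f
  sum-inv f = sym (sum-permute f (permutation 𝔽.inv 𝔽.inv 𝔽.inv-involutive 𝔽.inv-involutive))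

  sum-𝟙⊕ : ∀ f → sum (λ α → f (𝟙 ⊕ α)) ≈ sum f
  sum-𝟙⊕ f = sym (sum-permute f (permutation (𝟙 ⊕_) ((⊖ 𝟙) ⊕_)
    (λ α → cancel 𝟙 (⊖ 𝟙) α (𝔽.-‿inverseʳ 𝟙)) (λ α → cancel (⊖ 𝟙) 𝟙 α (𝔽.-‿inverseˡ 𝟙))))
    where
    cancel : ∀ x y α → x ⊕ y ≡ 𝟘 → x ⊕ (y ⊕ α) ≡ α
    cancel x y α x+y≡𝟘 = ≡.trans (≡.sym (𝔽.+-assoc x y α)) (≡.trans (≡.cong (_⊕ α) x+y≡𝟘) (𝔽.+-identityˡ α))

  -- The Jacobi sum up to the sign ψᵃ(-1), in the form matching the equation 1 + x = y of the
  -- cyclotomic numbers.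
  K : ℕ → ℕ → Carrier
  K a b = sum (λ α → ψ a α * ψ b (𝟙 ⊕ α))

  jacobi≈K : ∀ a b → jacobi R F (ψ a) (ψ b) ≈ ψ a (⊖ 𝟙) * K a b
  jacobi≈K a b = begin
    jacobi R F (ψ a) (ψ b)                                        ≡⟨ sumR≡sum summand ⟩
    sum summand
                                                                  ≈⟨ sum-cong term ⟩
    sum (λ α → ψ a α * ψ b (𝟙 ⊕ (⊖ α)))                           ≈⟨ sum-⊖ (λ α → ψ a α * ψ b (𝟙 ⊕ (⊖ α))) ⟨
    sum (λ α → ψ a (⊖ α) * ψ b (𝟙 ⊕ (⊖ (⊖ α))))                   ≈⟨ sum-cong (λ α → trans (*-cong (ψ-⊖ α) (reflexive (≡.cong (λ β → ψ b (𝟙 ⊕ β)) (𝔽.-‿involutive α)))) (*-assoc _ _ _)) ⟩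
    sum (λ α → ψ a (⊖ 𝟙) * (ψ a α * ψ b (𝟙 ⊕ α)))                 ≈⟨ *-distribˡ-sum (ψ a (⊖ 𝟙)) (λ α → ψ a α * ψ b (𝟙 ⊕ α)) ⟨
    ψ a (⊖ 𝟙) * K a b                                             ∎
    where
    summand : Fin q → Carrier
    summand α = if ⌊ α Fin.≟ 𝟘 ⌋ ∨ ⌊ α Fin.≟ 𝟙 ⌋ then 0# else ψ a α * ψ b (𝟙 ⊕ (⊖ α))
    -- The points 0 and 1 left out of the Jacobi sum contribute nothing anyway, since even the
    -- trivial `ψ a` vanishes at 𝟘.
    term : ∀ α → summand α ≈ ψ a α * ψ b (𝟙 ⊕ (⊖ α))
    term α with α Fin.≟ 𝟘 | α Fin.≟ 𝟙
    ... | yes ≡.refl | _          = sym (trans (*-congʳ (ψ-𝟘 a)) (zeroˡ _))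
    ... | no _       | yes ≡.refl = sym (trans (*-congˡ (ψ-≡𝟘 b (𝔽.-‿inverseʳ 𝟙))) (zeroʳ _))
    ... | no _       | no _       = refl
    ψ-⊖ : ∀ α → ψ a (⊖ α) ≈ ψ a (⊖ 𝟙) * ψ a α
    ψ-⊖ α = trans (reflexive (≡.cong (ψ a) (≡.sym (𝔽.-1*x≈-x α)))) (ψ-⊗ a (⊖ 𝟙) α)

  K≈jacobi : ∀ a b → K a b ≈ ψ a (⊖ 𝟙) * jacobi R F (ψ a) (ψ b)
  K≈jacobi a b = begin
    K a b                                        ≈⟨ *-identityˡ _ ⟨
    1# * K a b                                   ≈⟨ *-congʳ (ψ⊖𝟙² a) ⟨
    ψ a (⊖ 𝟙) * ψ a (⊖ 𝟙) * K a b                ≈⟨ *-assoc _ _ _ ⟩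
    ψ a (⊖ 𝟙) * (ψ a (⊖ 𝟙) * K a b)              ≈⟨ *-congˡ (jacobi≈K a b) ⟨
    ψ a (⊖ 𝟙) * jacobi R F (ψ a) (ψ b)           ∎

  sum-omit : ∀ (β : Fin q) (f : Fin q → Carrier) → sum (λ α → f α - [ ⌊ α Fin.≟ β ⌋ ] * f α) ≈ sum f - f β
  sum-omit β f = trans (sum-- f (λ α → [ ⌊ α Fin.≟ β ⌋ ] * f α)) (+-congˡ (-‿cong (sum-δ β f)))

  omit-yes : ∀ {x} y → x ≈ 0# → x ≈ y - 1# * y
  omit-yes y x≈0 = trans x≈0 (sym (trans (+-congˡ (-‿cong (*-identityˡ y))) (-‿inverseʳ y)))

  omit-no : ∀ {x y} z → x ≈ y → x ≈ y - 0# * z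
  omit-no z x≈y = trans x≈y (sym (trans (+-congˡ (-‿cong (zeroˡ z))) (x-0≈x _)))

  sum-ψ𝟙⊕-omit-𝟘 : ∀ b → sum (λ α → ψ b (𝟙 ⊕ α) - [ ⌊ α Fin.≟ 𝟘 ⌋ ] * ψ b (𝟙 ⊕ α)) ≈ sum (ψ b) - 1#
  sum-ψ𝟙⊕-omit-𝟘 b = trans (sum-omit 𝟘 (λ α → ψ b (𝟙 ⊕ α)))
    (+-cong (sum-𝟙⊕ (ψ b)) (-‿cong (trans (reflexive (≡.cong (ψ b) (𝔽.+-identityʳ 𝟙))) (ψ-𝟙 b))))

  -- ψᵇ is 1 away from 𝟘, so only the term α = -1 is lost from the sum of ψᵃ.
  K-e∣b : ∀ a {b} → e ∣ b → K a b ≈ sum (ψ a) - ψ a (⊖ 𝟙)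
  K-e∣b a {b} e∣b = trans (sum-cong term) (sum-omit (⊖ 𝟙) (ψ a))
    where
    term : ∀ α → ψ a α * ψ b (𝟙 ⊕ α) ≈ ψ a α - [ ⌊ α Fin.≟ (⊖ 𝟙) ⌋ ] * ψ a α
    term α with α Fin.≟ (⊖ 𝟙)
    ... | yes ≡.refl = omit-yes (ψ a α) (trans (*-congˡ (ψ-≡𝟘 b (𝔽.-‿inverseʳ 𝟙))) (zeroʳ _))
    ... | no α≢⊖𝟙   = omit-no (ψ a α) (trans (*-congˡ (ψ-trivial e∣b 𝟙⊕α≢𝟘)) (*-identityʳ _))
      where
      𝟙⊕α≢𝟘 : 𝟙 ⊕ α ≢ 𝟘
      𝟙⊕α≢𝟘 eq = α≢⊖𝟙 (𝔽.x∙y⁻¹≈ε⇒x≈y α (⊖ 𝟙) (≡.trans (≡.cong (α ⊕_) (𝔽.-‿involutive 𝟙)) (≡.trans (𝔽.+-comm α 𝟙) eq)))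

  -- Now the term α = 0 is lost; it would have been ψᵇ(1) = 1.
  K-e∣a : ∀ {a} b → e ∣ a → K a b ≈ sum (ψ b) - 1#
  K-e∣a {a} b e∣a = trans (sum-cong term) (sum-ψ𝟙⊕-omit-𝟘 b)
    where
    term : ∀ α → ψ a α * ψ b (𝟙 ⊕ α) ≈ ψ b (𝟙 ⊕ α) - [ ⌊ α Fin.≟ 𝟘 ⌋ ] * ψ b (𝟙 ⊕ α)
    term α with α Fin.≟ 𝟘
    ... | yes ≡.refl = omit-yes (ψ b (𝟙 ⊕ α)) (trans (*-congʳ (ψ-𝟘 a)) (zeroˡ _))
    ... | no α≢𝟘    = omit-no (ψ b (𝟙 ⊕ α)) (trans (*-congʳ (ψ-trivial e∣a α≢𝟘)) (*-identityˡ _))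

  -- Substituting α ↦ α⁻¹ turns ψᵃ(α)ψᵇ(1 + α) into ψᵃ⁺ᵇ(α⁻¹)ψᵇ(1 + α).
  K-e∣a+b : ∀ {a} b → e ∣ a ℕ.+ b → K a b ≈ sum (ψ b) - 1#
  K-e∣a+b {a} b e∣a+b = trans (sym (sum-inv (λ α → ψ a α * ψ b (𝟙 ⊕ α)))) (trans (sum-cong term) (sum-ψ𝟙⊕-omit-𝟘 b))
    where
    term : ∀ α → ψ a (𝔽.inv α) * ψ b (𝟙 ⊕ 𝔽.inv α) ≈ ψ b (𝟙 ⊕ α) - [ ⌊ α Fin.≟ 𝟘 ⌋ ] * ψ b (𝟙 ⊕ α)
    term α = by-cases (α Fin.≟ 𝟘)
     where
     by-cases : (α≟𝟘 : Dec (α ≡ 𝟘)) → ψ a (𝔽.inv α) * ψ b (𝟙 ⊕ 𝔽.inv α) ≈ ψ b (𝟙 ⊕ α) - [ ⌊ α≟𝟘 ⌋ ] * ψ b (𝟙 ⊕ α)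
     by-cases (yes α≡𝟘) = omit-yes (ψ b (𝟙 ⊕ α)) (trans (*-congʳ (ψ-≡𝟘 a (𝔽.inv-𝟘 α≡𝟘))) (zeroˡ _))
     by-cases (no α≢𝟘)  = omit-no (ψ b (𝟙 ⊕ α)) (begin
      ψ a β * ψ b (𝟙 ⊕ β)                  ≡⟨ ≡.cong (λ x → ψ a β * ψ b x) 𝟙⊕β ⟩
      ψ a β * ψ b (β ⊗ (𝟙 ⊕ α))            ≈⟨ *-congˡ (ψ-⊗ b β (𝟙 ⊕ α)) ⟩
      ψ a β * (ψ b β * ψ b (𝟙 ⊕ α))        ≈⟨ *-assoc _ _ _ ⟨
      ψ a β * ψ b β * ψ b (𝟙 ⊕ α)          ≈⟨ *-congʳ (trans (sym (ψ-+ a b β)) (ψ-trivial e∣a+b (𝔽.inv-nonzero α≢𝟘))) ⟩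
      1# * ψ b (𝟙 ⊕ α)                     ≈⟨ *-identityˡ _ ⟩
      ψ b (𝟙 ⊕ α)                          ∎)
      where
      β = 𝔽.inv α
      𝟙⊕β : 𝟙 ⊕ β ≡ β ⊗ (𝟙 ⊕ α)
      𝟙⊕β = ≡.sym (≡.trans (𝔽.distribˡ β 𝟙 α)
        (≡.trans (≡.cong₂ _⊕_ (𝔽.*-identityʳ β) (≡.trans (𝔽.*-comm β α) (𝔽.x⊗inv α≢𝟘))) (𝔽.+-comm β 𝟙)))

  private
    f = (q ∸ 1) / e

    f*e≡q-1 : f ℕ.* e ≡ q ∸ 1
    f*e≡q-1 = m/n*n≡m e∣q-1

  -- The kernel has period e, so the e classes of exponents, each with f representatives, reassemble
  -- into the full range of q - 1 = e f exponents.
  DFT-periodize : ∀ (H : ℕ → Carrier) b →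
                  DFT (λ j → ∑< f (λ v → H (e ℕ.* v ℕ.+ toℕ j))) b ≈ ∑< (q ∸ 1) (λ l → H l * ζ^ (b ℕ.* l))
  DFT-periodize H b = begin
    DFT (λ j → ∑< f (λ v → H (e ℕ.* v ℕ.+ toℕ j))) b
      ≈⟨ DFT-sum {f} (λ v j → H (e ℕ.* toℕ v ℕ.+ toℕ j)) b ⟩
    ∑< f (λ v → DFT (λ j → H (e ℕ.* v ℕ.+ toℕ j)) b)
      ≈⟨ sum-cong {f} (λ v → sum-cong {e} (λ j → *-congˡ (period (toℕ v) (toℕ j)))) ⟩
    ∑< f (λ v → ∑< e (λ j → H (e ℕ.* v ℕ.+ j) * ζ^ (b ℕ.* (e ℕ.* v ℕ.+ j))))
      ≈⟨ ∑<-* f e (λ l → H l * ζ^ (b ℕ.* l)) ⟨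
    ∑< (f ℕ.* e) (λ l → H l * ζ^ (b ℕ.* l))
      ≡⟨ ≡.cong (λ n → ∑< n (λ l → H l * ζ^ (b ℕ.* l))) f*e≡q-1 ⟩
    ∑< (q ∸ 1) (λ l → H l * ζ^ (b ℕ.* l)) ∎
    where
    period : ∀ v j → ζ^ (b ℕ.* j) ≈ ζ^ (b ℕ.* (e ℕ.* v ℕ.+ j))
    period v j = begin
      ζ^ (b ℕ.* j)                                   ≈⟨ *-identityˡ _ ⟨
      1# * ζ^ (b ℕ.* j)                              ≈⟨ *-congʳ (e∣k⇒ζ^k≈1 (∣n⇒∣m*n b (m∣m*n v))) ⟨
      ζ^ (b ℕ.* (e ℕ.* v)) * ζ^ (b ℕ.* j)            ≈⟨ R^.^-+ ζ (b ℕ.* (e ℕ.* v)) (b ℕ.* j) ⟨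
      ζ^ (b ℕ.* (e ℕ.* v) ℕ.+ b ℕ.* j)               ≡⟨ ≡.cong ζ^_ (ℕₚ.*-distribˡ-+ b (e ℕ.* v) j) ⟨
      ζ^ (b ℕ.* (e ℕ.* v ℕ.+ j))                     ∎

  incidence : ℕ → ℕ → Carrier
  incidence k l = [ ⌊ (𝟙 ⊕ (g ^ k)) Fin.≟ (g ^ l) ⌋ ]

  fromℕ-cyc : ∀ i j → fromℕ (cyc F g e i j) ≈ ∑< f (λ v₁ → ∑< f (λ v₂ → incidence (e ℕ.* v₁ ℕ.+ toℕ i) (e ℕ.* v₂ ℕ.+ toℕ j)))
  fromℕ-cyc i j = trans (fromℕ-sum-upTo f _) (sum-cong {f} (λ v₁ → trans (fromℕ-sum-upTo f _) (sum-cong {f} (λ v₂ → fromℕ-indicator _))))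
    where
    fromℕ-indicator : ∀ b → fromℕ (if b then 1 else 0) ≈ [ b ]
    fromℕ-indicator true  = fromℕ-1
    fromℕ-indicator false = refl

  -- The bracket selects the one l with g^l = 1 + g^k. If 1 + g^k = 0 there is none, and ψᵇ vanishes
  -- as well.
  sum-incidence : ∀ b k → ∑< (q ∸ 1) (λ l → incidence k l * ζ^ (b ℕ.* l)) ≈ ψ b (𝟙 ⊕ (g ^ k))
  sum-incidence b k = sym (begin
    ψ b x
      ≈⟨ sum-δ x (ψ b) ⟨
    sum (λ β → [ ⌊ β Fin.≟ x ⌋ ] * ψ b β)
      ≈⟨ sum-generator R (λ β → [ ⌊ β Fin.≟ x ⌋ ] * ψ b β) ⟩
    [ ⌊ 𝟘 Fin.≟ x ⌋ ] * ψ b 𝟘 + ∑< (q ∸ 1) (λ l → [ ⌊ (g ^ l) Fin.≟ x ⌋ ] * ψ b (g ^ l))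
      ≈⟨ +-cong (trans (*-congˡ (ψ-𝟘 b)) (zeroʳ _))
                (sum-cong {q ∸ 1} (λ l → *-cong (reflexive (≡.cong [_] (⌊≟⌋-sym (g ^ toℕ l) x))) (ψ-g^ b (toℕ l)))) ⟩
    0# + ∑< (q ∸ 1) (λ l → incidence k l * ζ^ (b ℕ.* l))
      ≈⟨ +-identityˡ _ ⟩
    ∑< (q ∸ 1) (λ l → incidence k l * ζ^ (b ℕ.* l)) ∎)
    where x = 𝟙 ⊕ (g ^ k)

  -- The sum over columns yields ψᵇ(1 + g^k), the sum over rows attaches ψᵃ(g^k); the missing term α
  -- = 0 is zero.
  DFT-cyc : ∀ a b → DFT (λ i → DFT (λ j → fromℕ (cyc F g e i j)) b) a ≈ K a b
  DFT-cyc a b = begin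
    DFT (λ i → DFT (λ j → fromℕ (cyc F g e i j)) b) a
      ≈⟨ DFT-cong a inner ⟩
    DFT (λ i → ∑< f (λ v → ψ b (𝟙 ⊕ (g ^ (e ℕ.* v ℕ.+ toℕ i))))) a
      ≈⟨ DFT-periodize (λ k → ψ b (𝟙 ⊕ (g ^ k))) a ⟩
    ∑< (q ∸ 1) (λ k → ψ b (𝟙 ⊕ (g ^ k)) * ζ^ (a ℕ.* k))
      ≈⟨ sum-cong {q ∸ 1} (λ k → trans (*-comm _ _) (*-congʳ (sym (ψ-g^ a (toℕ k))))) ⟩
    ∑< (q ∸ 1) (λ k → ψ a (g ^ k) * ψ b (𝟙 ⊕ (g ^ k)))
      ≈⟨ +-identityˡ _ ⟨
    0# + ∑< (q ∸ 1) (λ k → ψ a (g ^ k) * ψ b (𝟙 ⊕ (g ^ k)))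
      ≈⟨ +-congʳ (trans (*-congʳ (ψ-𝟘 a)) (zeroˡ _)) ⟨
    ψ a 𝟘 * ψ b (𝟙 ⊕ 𝟘) + ∑< (q ∸ 1) (λ k → ψ a (g ^ k) * ψ b (𝟙 ⊕ (g ^ k)))
      ≈⟨ sum-generator R (λ α → ψ a α * ψ b (𝟙 ⊕ α)) ⟨
    K a b ∎
    where
    inner : ∀ i → DFT (λ j → fromℕ (cyc F g e i j)) b ≈ ∑< f (λ v → ψ b (𝟙 ⊕ (g ^ (e ℕ.* v ℕ.+ toℕ i))))
    inner i = begin
      DFT (λ j → fromℕ (cyc F g e i j)) b
        ≈⟨ DFT-cong b (fromℕ-cyc i) ⟩
      DFT (λ j → ∑< f (λ v₁ → ∑< f (λ v₂ → incidence (e ℕ.* v₁ ℕ.+ toℕ i) (e ℕ.* v₂ ℕ.+ toℕ j)))) b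
        ≈⟨ DFT-sum {f} (λ v₁ j → ∑< f (λ v₂ → incidence (e ℕ.* toℕ v₁ ℕ.+ toℕ i) (e ℕ.* v₂ ℕ.+ toℕ j))) b ⟩
      ∑< f (λ v₁ → DFT (λ j → ∑< f (λ v₂ → incidence (e ℕ.* v₁ ℕ.+ toℕ i) (e ℕ.* v₂ ℕ.+ toℕ j))) b)
        ≈⟨ sum-cong {f} (λ v₁ → trans (DFT-periodize (incidence (e ℕ.* toℕ v₁ ℕ.+ toℕ i)) b) (sum-incidence b (e ℕ.* toℕ v₁ ℕ.+ toℕ i))) ⟩
      ∑< f (λ v₁ → ψ b (𝟙 ⊕ (g ^ (e ℕ.* v₁ ℕ.+ toℕ i)))) ∎

  DFT-- : ∀ x y a → DFT (λ i → x i - y i) a ≈ DFT x a - DFT y a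
  DFT-- x y a = trans (sum-cong (λ i → *-distribʳ-- (x i) (y i) _)) (sum-- (λ i → x i * ζ^ (a ℕ.* toℕ i)) (λ i → y i * ζ^ (a ℕ.* toℕ i)))

  DFT-1 : ∀ b → DFT (λ _ → 1#) b ≈ ∑< e (powR R (ζ^ b))
  DFT-1 b = sum-cong {e} (λ j → trans (*-identityˡ _) (R^.^-* ζ b (toℕ j)))

  module _ (p : ℕ) (2≤e : 2 ≤ e) (odd : p ≡ 2 → OddOrder q) (even : p ≢ 2 → EvenOrder q) where

    C : Matrix e
    C = multMatrix p F g e

    -- The correction is constant along a row, so the transform factors. The only nonzero row is the
    -- class c of log(-1), and ζ^(ac) = ψᵃ(-1).
    DFT-D : ∀ a b → DFT (λ i → DFT (λ j → fromℕ (Dδ p q e i ℕ.* f)) b) a ≈ ψ a (⊖ 𝟙) * (fromℕ f * DFT (λ _ → 1#) b)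
    DFT-D a b with Dδ-indicator F gen p e 2≤e e∣q-1 odd even
    ... | c , v , g^≡⊖𝟙 , D≡ = begin
      DFT (λ i → DFT (λ j → fromℕ (Dδ p q e i ℕ.* f)) b) a
        ≈⟨ DFT-cong a (λ i → trans (DFT-cong b (λ j → entry i)) (DFT-scale ([ ⌊ i Fin.≟ c ⌋ ] * fromℕ f) (λ _ → 1#) b)) ⟩
      DFT (λ i → [ ⌊ i Fin.≟ c ⌋ ] * fromℕ f * DFT (λ _ → 1#) b) a
        ≈⟨ sum-cong {e} (λ i → trans (*-congʳ (*-assoc _ _ _)) (*-assoc _ _ _)) ⟩
      sum (λ i → [ ⌊ i Fin.≟ c ⌋ ] * (fromℕ f * DFT (λ _ → 1#) b * ζ^ (a ℕ.* toℕ i)))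
        ≈⟨ sum-δ c (λ i → fromℕ f * DFT (λ _ → 1#) b * ζ^ (a ℕ.* toℕ i)) ⟩
      fromℕ f * DFT (λ _ → 1#) b * ζ^ (a ℕ.* toℕ c)
        ≈⟨ trans (*-comm _ _) (*-congʳ ζ^ac≈) ⟩
      ψ a (⊖ 𝟙) * (fromℕ f * DFT (λ _ → 1#) b) ∎
      where
      entry : ∀ i → fromℕ (Dδ p q e i ℕ.* f) ≈ [ ⌊ i Fin.≟ c ⌋ ] * fromℕ f * 1#
      entry i = trans (trans (fromℕ-* (Dδ p q e i) f) (*-congʳ D≈)) (sym (*-identityʳ _))
        where
        D≈ : fromℕ (Dδ p q e i) ≈ [ ⌊ i Fin.≟ c ⌋ ]
        D≈ rewrite D≡ i with i Fin.≟ c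
        ... | yes _ = fromℕ-1
        ... | no _  = refl
      ζ^ac≈ : ζ^ (a ℕ.* toℕ c) ≈ ψ a (⊖ 𝟙)
      ζ^ac≈ = begin
        ζ^ (a ℕ.* toℕ c)                                   ≈⟨ *-identityˡ _ ⟨
        1# * ζ^ (a ℕ.* toℕ c)                              ≈⟨ *-congʳ (e∣k⇒ζ^k≈1 (∣n⇒∣m*n a (m∣m*n v))) ⟨
        ζ^ (a ℕ.* (e ℕ.* v)) * ζ^ (a ℕ.* toℕ c)            ≈⟨ *-cong (ψ-g^ a (e ℕ.* v)) (ψ-g^ a (toℕ c)) ⟨
        ψ a (g ^ (e ℕ.* v)) * ψ a (g ^ toℕ c)              ≈⟨ ψ-⊗ a _ _ ⟨
        ψ a ((g ^ (e ℕ.* v)) ⊗ (g ^ toℕ c))                ≡⟨ ≡.cong (ψ a) (≡.trans (≡.sym (𝔽.^-+ g (e ℕ.* v) (toℕ c))) g^≡⊖𝟙) ⟩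
        ψ a (⊖ 𝟙)                                          ∎

    DFT²-C : ∀ a b → DFT² C a b ≈ K a b - ψ a (⊖ 𝟙) * (fromℕ f * DFT (λ _ → 1#) b)
    DFT²-C a b = begin
      DFT² C a b
        ≈⟨ DFT-cong a (λ i → trans (DFT-cong b (entry i)) (DFT-- (λ j → fromℕ (cyc F g e i j)) (λ j → fromℕ (Dδ p q e i ℕ.* f)) b)) ⟩
      DFT (λ i → DFT (λ j → fromℕ (cyc F g e i j)) b - DFT (λ j → fromℕ (Dδ p q e i ℕ.* f)) b) a
        ≈⟨ DFT-- (λ i → DFT (λ j → fromℕ (cyc F g e i j)) b) (λ i → DFT (λ j → fromℕ (Dδ p q e i ℕ.* f)) b) a ⟩
      DFT (λ i → DFT (λ j → fromℕ (cyc F g e i j)) b) a - DFT (λ i → DFT (λ j → fromℕ (Dδ p q e i ℕ.* f)) b) a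
        ≈⟨ +-cong (DFT-cyc a b) (-‿cong (DFT-D a b)) ⟩
      K a b - ψ a (⊖ 𝟙) * (fromℕ f * DFT (λ _ → 1#) b) ∎
      where
      entry : ∀ i j → fromℤ (C i j) ≈ fromℕ (cyc F g e i j) - fromℕ (Dδ p q e i ℕ.* f)
      entry i j = trans (fromℤ-+ (+ cyc F g e i j) (ℤ.- (+ (Dδ p q e i ℕ.* f)))) (+-congˡ (fromℤ-neg (+ (Dδ p q e i ℕ.* f))))

    DFT²-C-e∤b : ∀ a {b} → e ∤ b → DFT² C a b ≈ K a b
    DFT²-C-e∤b a {b} e∤b = begin
      DFT² C a b
        ≈⟨ DFT²-C a b ⟩
      K a b - ψ a (⊖ 𝟙) * (fromℕ f * DFT (λ _ → 1#) b)
        ≈⟨ +-congˡ (-‿cong (trans (*-congˡ (trans (*-congˡ (trans (DFT-1 b) (∑<-root e ([ζ^k]^e≈1 b) (e∤b ∘ ζ^k≈1⇒e∣k b)))) (zeroʳ _))) (zeroʳ _))) ⟩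
      K a b - 0#
        ≈⟨ x-0≈x _ ⟩
      K a b ∎

    DFT²-C-e∣b : ∀ a {b} → e ∣ b → DFT² C a b ≈ K a b - ψ a (⊖ 𝟙) * fromℕ (q ∸ 1)
    DFT²-C-e∣b a {b} e∣b = trans (DFT²-C a b) (+-congˡ (-‿cong (*-congˡ (begin
      fromℕ f * DFT (λ _ → 1#) b      ≈⟨ *-congˡ (trans (DFT-1 b) (∑<-one e (e∣k⇒ζ^k≈1 e∣b))) ⟩
      fromℕ f * fromℕ e               ≈⟨ fromℕ-* f e ⟨
      fromℕ (f ℕ.* e)                 ≡⟨ ≡.cong fromℕ f*e≡q-1 ⟩
      fromℕ (q ∸ 1)                   ∎))))

    DFT²-C-jacobi : ∀ a {b} → e ∤ b → DFT² C a b ≈ ψ a (⊖ 𝟙) * jacobi R F (ψ a) (ψ b)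
    DFT²-C-jacobi a e∤b = trans (DFT²-C-e∤b a e∤b) (K≈jacobi a _)

    DFT²-C-a+b≡0 : ∀ {a b} → e ∤ b → e ∣ a ℕ.+ b → DFT² C a b ≈ - 1#
    DFT²-C-a+b≡0 {a} {b} e∤b e∣a+b = begin
      DFT² C a b          ≈⟨ DFT²-C-e∤b a e∤b ⟩
      K a b               ≈⟨ K-e∣a+b b e∣a+b ⟩
      sum (ψ b) - 1#      ≈⟨ +-congʳ (sum-ψ-nontrivial e∤b) ⟩
      0# - 1#             ≈⟨ +-identityˡ _ ⟩
      - 1#                ∎

    DFT²-C-a≡0 : ∀ {a} b → e ∣ a → DFT² C a b ≈ - 1#
    DFT²-C-a≡0 {a} b e∣a with e ∣? b
    ... | no e∤b = begin
      DFT² C a b          ≈⟨ DFT²-C-e∤b a e∤b ⟩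
      K a b               ≈⟨ K-e∣a b e∣a ⟩
      sum (ψ b) - 1#      ≈⟨ +-congʳ (sum-ψ-nontrivial e∤b) ⟩
      0# - 1#             ≈⟨ +-identityˡ _ ⟩
      - 1#                ∎
    -- With both characters trivial, K counts the q - 2 points other than 0 and -1, and the
    -- correction takes away q - 1.
    ... | yes e∣b = begin
      DFT² C a b                                           ≈⟨ DFT²-C-e∣b a e∣b ⟩
      K a b - ψ a (⊖ 𝟙) * fromℕ (q ∸ 1)                    ≈⟨ +-cong (trans (K-e∣a b e∣a) (+-congʳ (sum-ψ-trivial e∣b)))
                                                                     (-‿cong (trans (*-congʳ (ψ-trivial e∣a 𝔽.⊖𝟙≢𝟘)) (*-identityˡ _))) ⟩
      (fromℕ (q ∸ 1) - 1#) - fromℕ (q ∸ 1)                 ≈⟨ [x+y]-x≈y (fromℕ (q ∸ 1)) (- 1#) ⟩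
      - 1#                                                 ∎

    DFT²-C-b≡0 : ∀ {a b} → e ∤ a → e ∣ b → DFT² C a b ≈ - (ψ a (⊖ 𝟙) * fromℕ q)
    DFT²-C-b≡0 {a} {b} e∤a e∣b = begin
      DFT² C a b                                           ≈⟨ DFT²-C-e∣b a e∣b ⟩
      K a b - s * fromℕ (q ∸ 1)                            ≈⟨ +-congʳ (trans (K-e∣b a e∣b) (trans (+-congʳ (sum-ψ-nontrivial e∤a)) (+-identityˡ _))) ⟩
      - s - s * fromℕ (q ∸ 1)                              ≈⟨ -‿+-comm _ _ ⟩
      - (s + s * fromℕ (q ∸ 1))                            ≈⟨ -‿cong (+-congʳ (*-identityʳ s)) ⟨
      - (s * 1# + s * fromℕ (q ∸ 1))                       ≈⟨ -‿cong (distribˡ s 1# _) ⟨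
      - (s * (1# + fromℕ (q ∸ 1)))                         ≡⟨ ≡.cong (λ n → - (s * fromℕ n)) q≡1+[q-1] ⟨
      - (s * fromℕ q)                                      ∎
      where s = ψ a (⊖ 𝟙)

-- Correctness of the discrete logarithm.

-- The search loop of dlog is local to its definition, so it has no name here; `loop` below recovers
-- it as the solution of a unification problem.  For that its fuel must be a variable independent of
-- the size of the field, which is why the size is written suc (1+head s) with an abstract 1+head:
-- the loop unfolds twice where 1+head is transparent and is read off where it is opaque.
module Search where
  open FiniteFieldOn using (dlog; _^_)

  -- Supplying `refl` forces the endpoints to be unified while the type is being formed, which
  -- solves a placeholder in `y`.
  TypeOf : {A : Set} {x y : A} → x ≡ y → Set
  TypeOf {x = x} {y} _ = x ≡ y

  elseBranch : (c : Bool) (x : ℕ) {y z : ℕ} → z ≡ (if c then x else y) → ℕ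
  elseBranch _ _ {y = y} _ = y

  abstract
    1+head : (ℕ → ℕ) → ℕ
    1+head s = suc (s 0)

  module _ (s : ℕ → ℕ) (F : FiniteFieldOn (suc (1+head s))) (g α : Fin (suc (1+head s))) where
    mutual
      unfold₁ : dlog F g α ≡ (if ⌊ _^_ F g 0 Fin.≟ α ⌋ then 0 else _)
      unfold₁ = ≡.refl

  abstract
    record Unfold₂ (s : ℕ → ℕ) (F : FiniteFieldOn (suc (1+head s))) (g α : Fin (suc (1+head s))) : Set where
      field
        unfold₂ : TypeOf {x = elseBranch ⌊ _^_ F g 0 Fin.≟ α ⌋ 0 (unfold₁ s F g α)}
                         {y = if ⌊ _^_ F g 1 Fin.≟ α ⌋ then 1 else _} ≡.refl

    unfold-twice : ∀ s F g α → Unfold₂ s F g α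
    unfold-twice s F g α = record { unfold₂ = ≡.refl }

  module _ (s : ℕ → ℕ) (F : FiniteFieldOn (suc (1+head s))) (g α : Fin (suc (1+head s))) where
    mutual
      loop : ℕ → ℕ → ℕ
      loop = _

      unfold₂ : elseBranch ⌊ _^_ F g 0 Fin.≟ α ⌋ 0 (unfold₁ s F g α) ≡ (if ⌊ _^_ F g 1 Fin.≟ α ⌋ then 1 else loop (s 0) 2)
      -- Once `s 0` and 2 are abstracted to variables, `loop` is applied to distinct variables and
      -- its placeholder has a unique solution.
      unfold₂ with s 0 | 2 | Unfold₂.unfold₂ (unfold-twice s F g α)
      ... | fuel | k | eq = eq

    private
      _⋆_ = _^_ F
      stop-or : ∀ k r → (g ⋆ k ≢ α → g ⋆ r ≡ α) → g ⋆ (if ⌊ (g ⋆ k) Fin.≟ α ⌋ then k else r) ≡ α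
      stop-or k r go-on with (g ⋆ k) Fin.≟ α
      ... | yes g^k≡α = g^k≡α
      ... | no g^k≢α  = go-on g^k≢α

    -- Invariant: a solution j remains among the `fuel` candidates starting at k. A miss at k
    -- excludes j = k, and an empty window is contradictory.
    loop-correct : ∀ fuel k j → k ≤ j → j < k ℕ.+ fuel → g ⋆ j ≡ α → g ⋆ loop fuel k ≡ α
    loop-correct zero k j k≤j j<k+0 g^j≡α =
      contradiction (ℕₚ.<-≤-trans j<k+0 (ℕₚ.≤-reflexive (ℕₚ.+-identityʳ k))) (ℕₚ.≤⇒≯ k≤j)
    loop-correct (suc fuel) k j k≤j j<k+1+fuel g^j≡α = stop-or k (loop fuel (suc k)) λ g^k≢α →
      loop-correct fuel (suc k) j (ℕₚ.≤∧≢⇒< k≤j λ { ≡.refl → g^k≢α g^j≡α })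
        (≡.subst (j <_) (ℕₚ.+-suc k fuel) j<k+1+fuel) g^j≡α

    dlog-correct′ : ∀ j → j < suc (suc (s 0)) → g ⋆ j ≡ α → g ⋆ dlog F g α ≡ α
    dlog-correct′ j j< g^j≡α = ≡.subst (λ d → g ⋆ d ≡ α) (≡.sym (unfold₁ s F g α))
      (stop-or 0 _ λ g^0≢α → ≡.subst (λ d → g ⋆ d ≡ α) (≡.sym unfold₂)
        (stop-or 1 (loop (s 0) 2) λ g^1≢α → loop-correct (s 0) 2 j
          (ℕₚ.≤∧≢⇒< (ℕₚ.n≢0⇒n>0 λ { ≡.refl → g^0≢α g^j≡α }) λ { ≡.refl → g^1≢α g^j≡α }) j< g^j≡α))

  abstract
    -- Inside the `abstract` block `1+head (λ _ → m)` computes to `suc m`, so the auxiliary form of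
    -- the size disappears from the statement.
    dlog-correct-2+ : ∀ {m} (F : FiniteFieldOn (suc (suc m))) (g α : Fin (suc (suc m))) →
                      ∀ j → j < suc (suc m) → _^_ F g j ≡ α → _^_ F g (dlog F g α) ≡ α
    dlog-correct-2+ {m} = dlog-correct′ (λ _ → m)

dlog-correct : ∀ {q} (F : FiniteFieldOn q) {g} → IsGenerator F g → ∀ {α} → α ≢ FiniteFieldOn.𝟘 F →
               FiniteFieldOn._^_ F g (FiniteFieldOn.dlog F g α) ≡ α
dlog-correct {zero}        F gen = contradiction (FiniteFieldOn.𝟘 F) Finₚ.¬Fin0
dlog-correct {suc zero}    F gen = contradiction (Fin1-unique (FiniteFieldOn.𝟘 F) (FiniteFieldOn.𝟙 F)) (FiniteFieldOn.𝟘≢𝟙 F)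
dlog-correct {suc (suc m)} F {g} gen {α} α≢𝟘 with proj₂ gen α α≢𝟘
-- The exponent provided by the generator may exceed the search range; reducing it mod q - 1 brings
-- it inside.
... | k , g^k≡α = Search.dlog-correct-2+ F g α (k % suc m) (ℕₚ.m<n⇒m<1+n (m%n<n k (suc m)))
                    (≡.trans (^-% (suc m) (Generator.generator-order F gen) k) g^k≡α)
  where open FieldProperties F using (^-%)

-- The powers of χ as functions on the field.

module Order {q : ℕ} (F : FiniteFieldOn q) {g : Fin q} (gen : IsGenerator F g) where
  open FiniteFieldOn F hiding (IsGenerator)
  open FieldProperties F
  open Generator F gen

  private instance
    q-1≢0 : NonZero (q ∸ 1)
    q-1≢0 = ℕ.>-nonZero 1≤q-1

  g^d≡𝟙⇒q-1∣d : ∀ d → g ^ d ≡ 𝟙 → (q ∸ 1) ∣ d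
  g^d≡𝟙⇒q-1∣d d g^d≡𝟙 with d % (q ∸ 1) in d%≡
  ... | zero  = m%n≡0⇒n∣m d (q ∸ 1) d%≡
  ... | r@(suc _) = contradiction (order-minimal r (≡.trans (≡.cong (g ^_) (≡.sym d%≡)) (≡.trans (^-% (q ∸ 1) generator-order d) g^d≡𝟙)))
                  (ℕₚ.<⇒≱ (≡.subst (_< q ∸ 1) d%≡ (m%n<n d (q ∸ 1))))

module Character
  (R : CommutativeRing 0ℓ 0ℓ) (domain : IsCharZeroDomain R)
  (e : ℕ) .{{_ : NonZero e}} (ζ : CommutativeRing.Carrier R) (ζ-prim : IsPrimitiveRoot R e ζ) where
  open CommutativeRing R hiding (zero)
  open RingSums R
  open Fourier R domain e ζ ζ-prim
  open import Relation.Binary.Reasoning.Setoid setoid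

  ζ^-cong-+ : ∀ {u v} k → u ≡ v ℕ.+ k ℕ.* e → ζ ^ u ≈ ζ ^ v
  ζ^-cong-+ {v = v} k ≡.refl = trans (^-+ ζ v (k ℕ.* e)) (trans (*-congˡ (e∣k⇒ζ^k≈1 (divides k ≡.refl))) (*-identityʳ _))

  -- Only natural powers of ζ exist here, so for negative d the multiple of e is moved to the other
  -- side.
  ζ^-congℤ : ∀ {u v} d → + u ≡ + v ℤ.+ d ℤ.* + e → ζ ^ u ≈ ζ ^ v
  ζ^-congℤ {u} {v} (+ k)    eq = ζ^-cong-+ k (ℤₚ.+-injective (≡.trans eq (≡.trans (≡.cong (λ z → + v ℤ.+ z) (≡.sym (ℤₚ.pos-* k e))) (≡.sym (ℤₚ.pos-+ v (k ℕ.* e))))))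
  ζ^-congℤ {u} {v} -[1+ k ] eq = sym (ζ^-cong-+ {v = u} (suc k) (ℤₚ.+-injective (≡.trans (transpose (+ u) (+ v) (+ suc k) (+ e) eq) (≡.trans (≡.cong (λ z → + u ℤ.+ z) (≡.sym (ℤₚ.pos-* (suc k) e))) (≡.sym (ℤₚ.pos-+ u (suc k ℕ.* e)))))))
    where
    transpose : ∀ x y k e → x ≡ y ℤ.+ ℤ.- k ℤ.* e → y ≡ x ℤ.+ k ℤ.* e
    transpose x y k e ≡.refl = identity y k e
      where
      identity : ∀ y k e → y ≡ y ℤ.+ ℤ.- k ℤ.* e ℤ.+ k ℤ.* e
      identity = solve-∀

  ζ^-%ℕ : ∀ x c u → x ≡ + u ℤ.+ c ℤ.* + e → ζ ^ (x %ℕ e) ≈ ζ ^ u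
  ζ^-%ℕ x c u eq = ζ^-congℤ (c ℤ.- x /ℕ e)
    (rearrange (+ (x %ℕ e)) (x /ℕ e) (+ u) c (+ e) (≡.trans (≡.sym (ℤDM.a≡a%ℕn+[a/ℕn]*n x e)) eq))
    where
    rearrange : ∀ r k u c e → r ℤ.+ k ℤ.* e ≡ u ℤ.+ c ℤ.* e → r ≡ u ℤ.+ (c ℤ.- k) ℤ.* e
    rearrange r k u c e eq = ≡.trans (lhs r k e) (≡.trans (≡.cong (ℤ._- k ℤ.* e) eq) (rhs k u c e))
      where
      lhs : ∀ r k e → r ≡ r ℤ.+ k ℤ.* e ℤ.- k ℤ.* e
      lhs = solve-∀
      rhs : ∀ k u c e → u ℤ.+ c ℤ.* e ℤ.- k ℤ.* e ≡ u ℤ.+ (c ℤ.- k) ℤ.* e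
      rhs = solve-∀

  module _ {q : ℕ} (F : FiniteFieldOn q) {g : Fin q} (gen : IsGenerator F g) (e∣q-1 : e ∣ q ∸ 1) where
    private module 𝔽 = FiniteFieldOn F

    ζ^-cong-≤ : ∀ {l k} → l ≤ k → g 𝔽.^ l ≡ g 𝔽.^ k → ζ ^ k ≈ ζ ^ l
    ζ^-cong-≤ {l} {k} l≤k eq = begin
      ζ ^ k                      ≡⟨ ≡.cong (ζ ^_) (ℕₚ.m+[n∸m]≡n l≤k) ⟨
      ζ ^ (l ℕ.+ (k ∸ l))        ≈⟨ ^-+ ζ l (k ∸ l) ⟩
      ζ ^ l * ζ ^ (k ∸ l)        ≈⟨ *-congˡ (e∣k⇒ζ^k≈1 (∣-trans e∣q-1 (Order.g^d≡𝟙⇒q-1∣d F gen (k ∸ l) (FieldProperties.^-∸ F (proj₁ gen) l≤k eq)))) ⟩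
      ζ ^ l * 1#                 ≈⟨ *-identityʳ _ ⟩
      ζ ^ l                      ∎

    -- The exponents differ by a multiple of q - 1, hence of e. This makes the character independent
    -- of which logarithm `dlog` returns.
    g^l≡g^k⇒ζ^l≈ζ^k : ∀ l k → g 𝔽.^ l ≡ g 𝔽.^ k → ζ ^ l ≈ ζ ^ k
    g^l≡g^k⇒ζ^l≈ζ^k l k eq with ℕₚ.≤-total l k
    ... | inj₁ l≤k = sym (ζ^-cong-≤ l≤k eq)
    ... | inj₂ k≤l = ζ^-cong-≤ k≤l (≡.sym eq)

    χ : ℤ → Fin q → Carrier
    χ = chiPow R F g e ζ

    χ-𝟘 : ∀ a {α} → α ≡ 𝔽.𝟘 → χ a α ≈ 0#
    χ-𝟘 a {α} α≡𝟘 with α Fin.≟ 𝔽.𝟘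
    ... | yes _   = refl
    ... | no α≢𝟘 = contradiction α≡𝟘 α≢𝟘

    χ-dlog : ∀ a {α} → α ≢ 𝔽.𝟘 → χ a α ≈ ζ ^ ((a %ℕ e) ℕ.* 𝔽.dlog g α)
    χ-dlog a {α} α≢𝟘 with α Fin.≟ 𝔽.𝟘
    ... | yes α≡𝟘 = contradiction α≡𝟘 α≢𝟘
    ... | no _     = ζ^-%ℕ (a ℤ.* + l) ((a /ℕ e) ℤ.* + l) ((a %ℕ e) ℕ.* l)
      (≡.trans (≡.cong (ℤ._* + l) (ℤDM.a≡a%ℕn+[a/ℕn]*n a e))
        (≡.trans (expand (+ (a %ℕ e)) (a /ℕ e) (+ e) (+ l)) (≡.cong (ℤ._+ (a /ℕ e) ℤ.* + l ℤ.* + e) (≡.sym (ℤₚ.pos-* (a %ℕ e) l)))))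
      where
      l = 𝔽.dlog g α
      expand : ∀ r k e l → (r ℤ.+ k ℤ.* e) ℤ.* l ≡ r ℤ.* l ℤ.+ k ℤ.* l ℤ.* e
      expand = solve-∀

    χ-g^ : ∀ a k → χ (+ a) (g 𝔽.^ k) ≈ ζ ^ (a ℕ.* k)
    χ-g^ a k = begin
      χ (+ a) (g 𝔽.^ k)                ≈⟨ χ-dlog (+ a) (FieldProperties.^-nonzero F k (proj₁ gen)) ⟩
      ζ ^ ((a % e) ℕ.* l)              ≈⟨ ^-* ζ (a % e) l ⟩
      (ζ ^ (a % e)) ^ l                ≈⟨ ^-cong l (ζ^% a) ⟩
      (ζ ^ a) ^ l                      ≈⟨ ^-* ζ a l ⟨
      ζ ^ (a ℕ.* l)                    ≡⟨ ≡.cong (ζ ^_) (ℕₚ.*-comm a l) ⟩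
      ζ ^ (l ℕ.* a)                    ≈⟨ ^-* ζ l a ⟩
      (ζ ^ l) ^ a                      ≈⟨ ^-cong a (g^l≡g^k⇒ζ^l≈ζ^k l k (dlog-correct F gen (FieldProperties.^-nonzero F k (proj₁ gen)))) ⟩
      (ζ ^ k) ^ a                      ≈⟨ ^-* ζ k a ⟨
      ζ ^ (k ℕ.* a)                    ≡⟨ ≡.cong (ζ ^_) (ℕₚ.*-comm k a) ⟩
      ζ ^ (a ℕ.* k)                    ∎
      where l = 𝔽.dlog g (g 𝔽.^ k)

    -- Lets integer exponents be replaced by natural ones, the only ones the transform knows.
    χ-%ℕ : ∀ a α → χ a α ≈ χ (+ (a %ℕ e)) α
    χ-%ℕ a α = by-cases (α Fin.≟ 𝔽.𝟘)
      where
      l = 𝔽.dlog g α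
      by-cases : Dec (α ≡ 𝔽.𝟘) → χ a α ≈ χ (+ (a %ℕ e)) α
      by-cases (yes α≡𝟘) = trans (χ-𝟘 a α≡𝟘) (sym (χ-𝟘 (+ (a %ℕ e)) α≡𝟘))
      by-cases (no α≢𝟘)  = begin
        χ a α                            ≈⟨ χ-dlog a α≢𝟘 ⟩
        ζ ^ ((a %ℕ e) ℕ.* l)             ≈⟨ χ-g^ (a %ℕ e) l ⟨
        χ (+ (a %ℕ e)) (g 𝔽.^ l)         ≡⟨ ≡.cong (χ (+ (a %ℕ e))) (dlog-correct F gen α≢𝟘) ⟩
        χ (+ (a %ℕ e)) α                 ∎

  jacobi-cong : ∀ {q} (F : FiniteFieldOn q) {φ φ′ ψ ψ′ : Fin q → Carrier} →
                (∀ α → φ α ≈ φ′ α) → (∀ α → ψ α ≈ ψ′ α) → jacobi R F φ ψ ≈ jacobi R F φ′ ψ′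
  jacobi-cong F {φ} {φ′} {ψ} {ψ′} φ≈ ψ≈ = trans (reflexive (sumR≡sum (summand φ ψ))) (trans (sum-cong term) (reflexive (≡.sym (sumR≡sum (summand φ′ ψ′)))))
    where
    open FiniteFieldOn F
    summand : (_ _ : Fin _ → Carrier) → Fin _ → Carrier
    summand φ ψ α = if ⌊ α Fin.≟ 𝟘 ⌋ ∨ ⌊ α Fin.≟ 𝟙 ⌋ then 0# else φ α * ψ (𝟙 ⊕ (⊖ α))
    term : ∀ α → summand φ ψ α ≈ summand φ′ ψ′ α
    term α with ⌊ α Fin.≟ 𝟘 ⌋ ∨ ⌊ α Fin.≟ 𝟙 ⌋
    ... | true  = refl
    ... | false = *-cong (φ≈ α) (ψ≈ (𝟙 ⊕ (⊖ α)))

-- Field embeddings, Frobenius and the norm.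

module Embedding {q q′ : ℕ} (F : FiniteFieldOn q) (K : FiniteFieldOn q′) (ι : Fin q → Fin q′) (emb : IsFieldEmbedding F K ι) where
  private
    module F = FiniteFieldOn F
    module K = FiniteFieldOn K
    module Fₚ = FieldProperties F
    module Kₚ = FieldProperties K
    module Kᵣ = RingSums Kₚ.fieldRing
  open IsFieldEmbedding emb
  open ≡.≡-Reasoning

  ι-𝟘 : ι F.𝟘 ≡ K.𝟘
  ι-𝟘 = Kᵣ.+-identityʳ-unique (ι F.𝟘) (ι F.𝟘) (≡.trans (≡.sym (pres-⊕ F.𝟘 F.𝟘)) (≡.cong ι (Fₚ.+-identityʳ F.𝟘)))

  ι-⊖ : ∀ x → ι (F.⊖ x) ≡ K.⊖ (ι x)
  ι-⊖ x = Kᵣ.+-inverseˡ-unique (ι (F.⊖ x)) (ι x)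
    (≡.trans (≡.sym (pres-⊕ (F.⊖ x) x)) (≡.trans (≡.cong ι (Fₚ.-‿inverseˡ x)) ι-𝟘))

  ι-^ : ∀ x k → ι (x F.^ k) ≡ ι x K.^ k
  ι-^ x zero    = pres-𝟙
  ι-^ x (suc k) = ≡.trans (pres-⊗ x (x F.^ k)) (≡.cong (ι x K.⊗_) (ι-^ x k))

  ι-nonzero : ∀ {x} → x ≢ F.𝟘 → ι x ≢ K.𝟘
  ι-nonzero {x} x≢𝟘 ιx≡𝟘 with F.inverse x x≢𝟘
  ... | y , xy≡𝟙 = K.𝟘≢𝟙 (begin
    K.𝟘                ≡⟨ Kₚ.zeroˡ (ι y) ⟨
    K.𝟘 K.⊗ ι y        ≡⟨ ≡.cong (K._⊗ ι y) ιx≡𝟘 ⟨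
    ι x K.⊗ ι y        ≡⟨ pres-⊗ x y ⟨
    ι (x F.⊗ y)        ≡⟨ ≡.cong ι xy≡𝟙 ⟩
    ι F.𝟙              ≡⟨ pres-𝟙 ⟩
    K.𝟙                ∎)

  ι-injective : ∀ {x y} → ι x ≡ ι y → x ≡ y
  ι-injective {x} {y} ιx≡ιy with (x F.⊕ (F.⊖ y)) Fin.≟ F.𝟘
  ... | yes x-y≡𝟘 = Fₚ.x∙y⁻¹≈ε⇒x≈y x y x-y≡𝟘
  ... | no x-y≢𝟘  = contradiction (begin
    ι (x F.⊕ (F.⊖ y))          ≡⟨ pres-⊕ x (F.⊖ y) ⟩
    ι x K.⊕ ι (F.⊖ y)          ≡⟨ ≡.cong₂ K._⊕_ ιx≡ιy (ι-⊖ y) ⟩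
    ι y K.⊕ (K.⊖ (ι y))        ≡⟨ Kₚ.-‿inverseʳ (ι y) ⟩
    K.𝟘                        ∎) (ι-nonzero x-y≢𝟘)

module Frobenius {q : ℕ} (F : FiniteFieldOn q) {g : Fin q} (gen : IsGenerator F g) where
  open FiniteFieldOn F hiding (IsGenerator)
  open FieldProperties F
  open Generator F gen
  open ≡.≡-Reasoning

  ^q≡ : ∀ {x} → x ≢ 𝟘 → x ^ q ≡ x
  ^q≡ {x} x≢𝟘 = begin
    x ^ q                  ≡⟨ ≡.cong (x ^_) (ℕₚ.m+[n∸m]≡n (ℕₚ.≤-trans 1≤q-1 (ℕₚ.m∸n≤m q 1))) ⟨
    x ⊗ (x ^ (q ∸ 1))      ≡⟨ ≡.cong (x ⊗_) (nonzero^[q-1] x≢𝟘) ⟩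
    x ⊗ 𝟙                  ≡⟨ *-identityʳ x ⟩
    x                      ∎

  ^q^i≡ : ∀ {x} → x ≢ 𝟘 → ∀ i → x ^ (q ℕ.^ i) ≡ x
  ^q^i≡ {x} x≢𝟘 zero    = *-identityʳ x
  ^q^i≡ {x} x≢𝟘 (suc i) = ≡.trans (^-* x q (q ℕ.^ i)) (≡.trans (≡.cong (_^ (q ℕ.^ i)) (^q≡ x≢𝟘)) (^q^i≡ x≢𝟘 i))

  -- In the base field x^q = x, so each of the n factors x^(q^i) of the norm is x.
  ^-normExp : ∀ {x} → x ≢ 𝟘 → ∀ n → x ^ normExp q n ≡ x ^ n
  ^-normExp {x} x≢𝟘 n = go n id
    where
    go : ∀ n (u : ℕ → ℕ) → x ^ sumℕ (map (λ i → q ℕ.^ i) (applyUpTo u n)) ≡ x ^ n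
    go zero    u = ≡.refl
    go (suc n) u = ≡.trans (^-+ x (q ℕ.^ u 0) _) (≡.cong₂ _⊗_ (^q^i≡ x≢𝟘 (u 0)) (go n (u ∘ suc)))

-- `Nr` is known only through `ι`; its properties are those of a power map on K, pulled back along
-- the injective `ι`.
module Norm {q q′ : ℕ} (F : FiniteFieldOn q) (K : FiniteFieldOn q′) (ι : Fin q → Fin q′) (emb : IsFieldEmbedding F K ι)
            (n′ : ℕ) (Nr : Fin q′ → Fin q)
            (ι-Nr : ∀ x → ι (Nr x) ≡ FiniteFieldOn._^_ K x (normExp q (suc n′))) where
  private
    module F = FiniteFieldOn F
    module K = FiniteFieldOn K
    module Kₚ = FieldProperties K
    N = normExp q (suc n′)
  open Embedding F K ι emb
  open ≡.≡-Reasoning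

  Nr-𝟘 : Nr K.𝟘 ≡ F.𝟘
  -- The norm exponent starts with q^0 = 1, hence is a successor, and the power of 𝟘 unfolds to a
  -- product with 𝟘.
  Nr-𝟘 = ι-injective (≡.trans (ι-Nr K.𝟘) (≡.trans (Kₚ.zeroˡ _) (≡.sym ι-𝟘)))

  Nr-nonzero : ∀ {x} → x ≢ K.𝟘 → Nr x ≢ F.𝟘
  Nr-nonzero {x} x≢𝟘 Nrx≡𝟘 = Kₚ.^-nonzero N x≢𝟘 (≡.trans (≡.sym (ι-Nr x)) (≡.trans (≡.cong ι Nrx≡𝟘) ι-𝟘))

  Nr-^ : ∀ x k → Nr (x K.^ k) ≡ Nr x F.^ k
  Nr-^ x k = ι-injective (begin
    ι (Nr (x K.^ k))       ≡⟨ ι-Nr (x K.^ k) ⟩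
    (x K.^ k) K.^ N        ≡⟨ Kₚ.^-comm x k N ⟩
    (x K.^ N) K.^ k        ≡⟨ ≡.cong (K._^ k) (ι-Nr x) ⟨
    ι (Nr x) K.^ k         ≡⟨ ι-^ (Nr x) k ⟨
    ι (Nr x F.^ k)         ∎)

  Nr-⊖𝟙 : ∀ {g} → IsGenerator F g → Nr (K.⊖ K.𝟙) ≡ (F.⊖ F.𝟙) F.^ suc n′
  Nr-⊖𝟙 gen = ι-injective (begin
    ι (Nr (K.⊖ K.𝟙))               ≡⟨ ι-Nr (K.⊖ K.𝟙) ⟩
    (K.⊖ K.𝟙) K.^ N                ≡⟨ ≡.cong (K._^ N) (≡.trans (ι-⊖ F.𝟙) (≡.cong K.⊖_ pres-𝟙)) ⟨
    ι (F.⊖ F.𝟙) K.^ N              ≡⟨ ι-^ (F.⊖ F.𝟙) N ⟨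
    ι ((F.⊖ F.𝟙) F.^ N)            ≡⟨ ≡.cong ι (Frobenius.^-normExp F gen (FieldProperties.⊖𝟙≢𝟘 F) (suc n′)) ⟩
    ι ((F.⊖ F.𝟙) F.^ suc n′)       ∎)
    where open IsFieldEmbedding emb using (pres-𝟙)

e∣%ℕ⇒e∣ : ∀ (e : ℕ) .{{_ : NonZero e}} a → e ∣ (a %ℕ e) → + e ℤD.∣ a
e∣%ℕ⇒e∣ e a e∣a%e = ℤDS.∣⇒∣ᵤ (≡.subst (+ e ℤDS.∣_) (≡.sym (ℤDM.a≡a%ℕn+[a/ℕn]*n a e))
  (ℤDS.∣m∣n⇒∣m+n (ℤDS.∣ᵤ⇒∣ {i = + (a %ℕ e)} e∣a%e) (ℤDS.∣n⇒∣m*n (a /ℕ e) ℤDS.∣-refl)))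

-- Comparison of the two fields.

module Lift
  (R : CommutativeRing 0ℓ 0ℓ) (domain : IsCharZeroDomain R)
  (e : ℕ) .{{_ : NonZero e}} (ζ : CommutativeRing.Carrier R) (ζ-prim : IsPrimitiveRoot R e ζ) (2≤e : 2 ≤ e)
  (p : ℕ) {q q′ : ℕ} (n′ : ℕ) (q′≡q^n : q′ ≡ q ℕ.^ suc n′)
  (odd : p ≡ 2 → OddOrder q) (even : p ≢ 2 → EvenOrder q) (odd′ : p ≡ 2 → OddOrder q′) (even′ : p ≢ 2 → EvenOrder q′)
  (F : FiniteFieldOn q) (K : FiniteFieldOn q′) (ι : Fin q → Fin q′) (emb : IsFieldEmbedding F K ι)
  (Nr : Fin q′ → Fin q) (ι-Nr : ∀ x → ι (Nr x) ≡ FiniteFieldOn._^_ K x (normExp q (suc n′)))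
  {γ : Fin q} (gen : IsGenerator F γ) (e∣q-1 : e ∣ q ∸ 1)
  {γ′ : Fin q′} (gen′ : IsGenerator K γ′) (e∣q′-1 : e ∣ q′ ∸ 1)
  (lift : CommutativeRing._≈_ R (chiPow R F γ e ζ (+ 1) (Nr γ′)) ζ)
  where
  open CommutativeRing R hiding (zero)
  open RingSums R
  open Fourier R domain e ζ ζ-prim
  open Character R domain e ζ ζ-prim
  private
    module F = FiniteFieldOn F
    module K = FiniteFieldOn K
  open Norm F K ι emb n′ Nr ι-Nr
  open import Relation.Binary.Reasoning.Setoid setoid

  ψ : ℕ → Fin q → Carrier
  ψ a = chiPow R F γ e ζ (+ a)

  ψ′ : ℕ → Fin q′ → Carrier
  ψ′ a α = ψ a (Nr α)

  ψ-𝟘 : ∀ a → ψ a F.𝟘 ≈ 0#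
  ψ-𝟘 a = χ-𝟘 F gen e∣q-1 (+ a) ≡.refl

  ψ-γ^ : ∀ a k → ψ a (γ F.^ k) ≈ ζ ^ (a ℕ.* k)
  ψ-γ^ = χ-g^ F gen e∣q-1

  ψ′-𝟘 : ∀ a → ψ′ a K.𝟘 ≈ 0#
  ψ′-𝟘 a = χ-𝟘 F gen e∣q-1 (+ a) Nr-𝟘

  -- Writing Nr γ′ = γ^l, the normalisation χ(Nr γ′) = ζ becomes ζ^l = ζ, and l drops out of every
  -- exponent.
  ψ′-γ′^ : ∀ a k → ψ′ a (γ′ K.^ k) ≈ ζ ^ (a ℕ.* k)
  ψ′-γ′^ a k with proj₂ gen (Nr γ′) (Nr-nonzero (proj₁ gen′))
  ... | l , γ^l≡Nrγ′ = begin
    ψ a (Nr (γ′ K.^ k))          ≡⟨ ≡.cong (ψ a) (≡.trans (Nr-^ γ′ k) (≡.trans (≡.cong (F._^ k) (≡.sym γ^l≡Nrγ′)) (≡.sym (FieldProperties.^-* F γ l k)))) ⟩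
    ψ a (γ F.^ (l ℕ.* k))        ≈⟨ ψ-γ^ a (l ℕ.* k) ⟩
    ζ ^ (a ℕ.* (l ℕ.* k))        ≡⟨ ≡.cong (ζ ^_) (≡.trans (ℕₚ.*-comm a (l ℕ.* k)) (≡.trans (ℕₚ.*-assoc l k a) (≡.cong (l ℕ.*_) (ℕₚ.*-comm k a)))) ⟩
    ζ ^ (l ℕ.* (a ℕ.* k))        ≈⟨ ^-* ζ l (a ℕ.* k) ⟩
    (ζ ^ l) ^ (a ℕ.* k)          ≈⟨ ^-cong (a ℕ.* k) ζ^l≈ζ ⟩
    ζ ^ (a ℕ.* k)                ∎
    where
    ζ^l≈ζ : ζ ^ l ≈ ζ
    ζ^l≈ζ = begin
      ζ ^ l              ≡⟨ ≡.cong (ζ ^_) (ℕₚ.*-identityˡ l) ⟨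
      ζ ^ (1 ℕ.* l)      ≈⟨ ψ-γ^ 1 l ⟨
      ψ 1 (γ F.^ l)      ≡⟨ ≡.cong (ψ 1) γ^l≡Nrγ′ ⟩
      ψ 1 (Nr γ′)        ≈⟨ lift ⟩
      ζ                  ∎

  private
    module S  = CharacterSums R domain e ζ ζ-prim F gen e∣q-1 ψ ψ-𝟘 ψ-γ^
    module S′ = CharacterSums R domain e ζ ζ-prim K gen′ e∣q′-1 ψ′ ψ′-𝟘 ψ′-γ′^

  n : ℕ
  n = suc n′

  s : ℕ → Carrier
  s a = ψ a (F.⊖ F.𝟙)

  s′ : ℕ → Carrier
  s′ a = ψ′ a (K.⊖ K.𝟙)

  J J′ : ℕ → ℕ → Carrier
  J  a b = jacobi R F (ψ a) (ψ b)
  J′ a b = jacobi R K (ψ′ a) (ψ′ b)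

  C C′ : Matrix e
  C  = multMatrix p F γ e
  C′ = multMatrix p K γ′ e

  ψ-^ : ∀ a x k → ψ a (x F.^ k) ≈ ψ a x ^ k
  ψ-^ a x zero    = S.ψ-𝟙 a
  ψ-^ a x (suc k) = trans (S.ψ-⊗ a x (x F.^ k)) (*-congˡ (ψ-^ a x k))

  s′≈s^n : ∀ a → s′ a ≈ s a ^ n
  s′≈s^n a = trans (reflexive (≡.cong (ψ a) (Nr-⊖𝟙 gen))) (ψ-^ a (F.⊖ F.𝟙) n)

  sgn : Carrier
  sgn = (- 1#) ^ n′

  -- With n = n′ + 1, the 2n′ + 1 factors -1 leave a single sign.
  sgn*[-x]^n : ∀ x → sgn * (- x) ^ n ≈ - (x ^ n)
  sgn*[-x]^n x = begin
    sgn * (- x) ^ n                             ≈⟨ *-congˡ (trans (^-cong n (sym (-1*x≈-x x))) (*-^ (- 1#) x n)) ⟩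
    sgn * ((- 1# * sgn) * x ^ n)                ≈⟨ *-assoc _ _ _ ⟨
    sgn * (- 1# * sgn) * x ^ n                  ≈⟨ *-congʳ (trans (*-congˡ (*-comm (- 1#) sgn)) (sym (*-assoc sgn sgn (- 1#)))) ⟩
    sgn * sgn * - 1# * x ^ n                    ≈⟨ *-congʳ (trans (*-congʳ sgn²≈1) (*-identityˡ _)) ⟩
    - 1# * x ^ n                                ≈⟨ -1*x≈-x _ ⟩
    - (x ^ n)                                   ∎
    where
    sgn²≈1 : sgn * sgn ≈ 1#
    sgn²≈1 = trans (sym (*-^ (- 1#) (- 1#) n′)) (x≈1⇒x^n≈1 n′ (trans (-1*x≈-x (- 1#)) (-‿involutive 1#)))

  fromℤ[-1]^ : fromℤ (-[1+ 0 ] ℤ.^ n′) ≈ sgn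
  fromℤ[-1]^ = trans (fromℤ-^ -[1+ 0 ] n′) (^-cong n′ (-‿cong fromℕ-1))

  DFT²-power : ∀ a b → DFT² (λ i j → (-[1+ 0 ] ℤ.^ n′) ℤ.* foldCompose e C n′ i j) a b ≈ sgn * DFT² C a b ^ n
  DFT²-power a b = trans (DFT²-scale (-[1+ 0 ] ℤ.^ n′) (foldCompose e C n′) a b) (*-cong fromℤ[-1]^ (DFT²-foldCompose C n′ a b))

  from-minus-one : ∀ a b → DFT² C′ a b ≈ - 1# → DFT² C a b ≈ - 1# → DFT² C′ a b ≈ sgn * DFT² C a b ^ n
  from-minus-one a b eq′ eq = trans eq′ (sym (trans (*-congˡ (^-cong n eq)) (trans (sgn*[-x]^n 1#) (-‿cong (1^ n)))))

  -- The norm of -1 is (-1)ⁿ, so the n-th power of the small field's factor ψᵃ(-1) is exactly that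
  -- of the large field.
  s′*x≈ : ∀ a x → sgn * (s a * x) ^ n ≈ s′ a * (sgn * x ^ n)
  s′*x≈ a x = begin
    sgn * (s a * x) ^ n            ≈⟨ *-congˡ (*-^ (s a) x n) ⟩
    sgn * (s a ^ n * x ^ n)        ≈⟨ *-assoc _ _ _ ⟨
    sgn * s a ^ n * x ^ n          ≈⟨ *-congʳ (*-comm sgn (s a ^ n)) ⟩
    s a ^ n * sgn * x ^ n          ≈⟨ *-assoc _ _ _ ⟩
    s a ^ n * (sgn * x ^ n)        ≈⟨ *-congʳ (s′≈s^n a) ⟨
    s′ a * (sgn * x ^ n)           ∎

  -- Off the lines a ≡ 0, b ≡ 0, a + b ≡ 0 the transforms are signed Jacobi sums; on them both sides
  -- are explicit and the identity always holds.
  jacobi⇒DFT² : (∀ a b → e ∤ a → e ∤ b → e ∤ a ℕ.+ b → J′ a b ≈ sgn * J a b ^ n) →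
                ∀ a b → DFT² C′ a b ≈ sgn * DFT² C a b ^ n
  jacobi⇒DFT² hyp a b with e ∣? a | e ∣? b | e ∣? a ℕ.+ b
  ... | yes e∣a | _ | _ = from-minus-one a b (S′.DFT²-C-a≡0 p 2≤e odd′ even′ b e∣a) (S.DFT²-C-a≡0 p 2≤e odd even b e∣a)
  ... | no e∤a | yes e∣b | _ = begin
    DFT² C′ a b                              ≈⟨ S′.DFT²-C-b≡0 p 2≤e odd′ even′ e∤a e∣b ⟩
    - (s′ a * fromℕ q′)                      ≈⟨ -‿cong (*-cong (s′≈s^n a) (trans (reflexive (≡.cong fromℕ q′≡q^n)) (fromℕ-^ q n))) ⟩
    - (s a ^ n * fromℕ q ^ n)                ≈⟨ -‿cong (*-^ (s a) (fromℕ q) n) ⟨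
    - ((s a * fromℕ q) ^ n)                  ≈⟨ sgn*[-x]^n (s a * fromℕ q) ⟨
    sgn * (- (s a * fromℕ q)) ^ n            ≈⟨ *-congˡ (^-cong n (S.DFT²-C-b≡0 p 2≤e odd even e∤a e∣b)) ⟨
    sgn * DFT² C a b ^ n                     ∎
  ... | no e∤a | no e∤b | yes e∣a+b = from-minus-one a b (S′.DFT²-C-a+b≡0 p 2≤e odd′ even′ e∤b e∣a+b) (S.DFT²-C-a+b≡0 p 2≤e odd even e∤b e∣a+b)
  ... | no e∤a | no e∤b | no e∤a+b = begin
    DFT² C′ a b                              ≈⟨ S′.DFT²-C-jacobi p 2≤e odd′ even′ a e∤b ⟩
    s′ a * J′ a b                            ≈⟨ *-congˡ (hyp a b e∤a e∤b e∤a+b) ⟩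
    s′ a * (sgn * J a b ^ n)                 ≈⟨ s′*x≈ a (J a b) ⟨
    sgn * (s a * J a b) ^ n                  ≈⟨ *-congˡ (^-cong n (S.DFT²-C-jacobi p 2≤e odd even a e∤b)) ⟨
    sgn * DFT² C a b ^ n                     ∎

  -- ψ′ᵃ(-1) is its own inverse, so multiplying by it strips the sign from both sides.
  DFT²⇒jacobi : ∀ a {b} → e ∤ b → DFT² C′ a b ≈ sgn * DFT² C a b ^ n → J′ a b ≈ sgn * J a b ^ n
  DFT²⇒jacobi a {b} e∤b eq = begin
    J′ a b                                   ≈⟨ cancel (J′ a b) ⟨
    s′ a * (s′ a * J′ a b)                   ≈⟨ *-congˡ (S′.DFT²-C-jacobi p 2≤e odd′ even′ a e∤b) ⟨
    s′ a * DFT² C′ a b                       ≈⟨ *-congˡ (trans eq (*-congˡ (^-cong n (S.DFT²-C-jacobi p 2≤e odd even a e∤b)))) ⟩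
    s′ a * (sgn * (s a * J a b) ^ n)         ≈⟨ *-congˡ (s′*x≈ a (J a b)) ⟩
    s′ a * (s′ a * (sgn * J a b ^ n))        ≈⟨ cancel _ ⟩
    sgn * J a b ^ n                          ∎
    where
    cancel : ∀ x → s′ a * (s′ a * x) ≈ x
    cancel x = trans (sym (*-assoc _ _ _)) (trans (*-congʳ (S′.ψ⊖𝟙² a)) (*-identityˡ x))

  equivalence :
    (∀ (a b : ℤ) → ¬ (+ e ℤD.∣ a) → ¬ (+ e ℤD.∣ b) → ¬ (+ e ℤD.∣ (a ℤ.+ b)) →
      jacobi R K (λ α → chiPow R F γ e ζ a (Nr α)) (λ α → chiPow R F γ e ζ b (Nr α))
        ≈ sgn * jacobi R F (chiPow R F γ e ζ a) (chiPow R F γ e ζ b) ^ n)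
    ⇔ (∀ i j → C′ i j ≡ (-[1+ 0 ] ℤ.^ n′) ℤ.* foldCompose e C n′ i j)
  equivalence = mk⇔
    (λ hyp → DFT²-injective C′ _ λ a b →
      trans (jacobi⇒DFT² (λ a b → hyp (+ a) (+ b)) (toℕ a) (toℕ b)) (sym (DFT²-power (toℕ a) (toℕ b))))
    -- The integers are replaced by their remainders, which index the same characters; e ∤ b passes
    -- to the remainder of b.
    (λ C′≡ a b e∤a e∤b _ → begin
      jacobi R K (λ α → chiPow R F γ e ζ a (Nr α)) (λ α → chiPow R F γ e ζ b (Nr α))
        ≈⟨ jacobi-cong K (λ α → χ-%ℕ F gen e∣q-1 a (Nr α)) (λ α → χ-%ℕ F gen e∣q-1 b (Nr α)) ⟩
      J′ (a %ℕ e) (b %ℕ e)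
        ≈⟨ DFT²⇒jacobi (a %ℕ e) (e∤b ∘ e∣%ℕ⇒e∣ e b) (trans (DFT²-cong (a %ℕ e) (b %ℕ e) C′≡) (DFT²-power (a %ℕ e) (b %ℕ e))) ⟩
      sgn * J (a %ℕ e) (b %ℕ e) ^ n
        ≈⟨ *-congˡ (^-cong n (jacobi-cong F (χ-%ℕ F gen e∣q-1 a) (χ-%ℕ F gen e∣q-1 b))) ⟨
      sgn * jacobi R F (chiPow R F γ e ζ a) (chiPow R F γ e ζ b) ^ n ∎)

-- Specialisation to fields of orders p^r and p^(nr).

open import Data.Nat using (_^_; _*_)

theorem1p3 :
  (e p r n : ℕ) .{{_ : NonZero e}} →
  2 ≤ e → Prime p → 1 ≤ r → e ∣ (p ^ r ∸ 1) → 1 ≤ n →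
  (F : FiniteFieldOn (p ^ r)) (K : FiniteFieldOn (p ^ (n * r))) →
  (ι : Fin (p ^ r) → Fin (p ^ (n * r))) → IsFieldEmbedding F K ι →
  (Nr : Fin (p ^ (n * r)) → Fin (p ^ r)) →
  (∀ x → ι (Nr x) ≡ FiniteFieldOn._^_ K x (normExp (p ^ r) n)) →
  (γ : Fin (p ^ r)) → IsGenerator F γ →
  (R : CommutativeRing 0ℓ 0ℓ) → IsCharZeroDomain R →
  (ζ : CommutativeRing.Carrier R) → IsPrimitiveRoot R e ζ →
  (γ′ : Fin (p ^ (n * r))) → IsGenerator K γ′ →
  CommutativeRing._≈_ R (chiPow R F γ e ζ (+ 1) (Nr γ′)) ζ →
  ((∀ (a b : ℤ) → ¬ (+ e ℤD.∣ a) → ¬ (+ e ℤD.∣ b) → ¬ (+ e ℤD.∣ (a ℤ.+ b)) →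
      CommutativeRing._≈_ R
        (jacobi R K (λ α → chiPow R F γ e ζ a (Nr α)) (λ α → chiPow R F γ e ζ b (Nr α)))
        (CommutativeRing._*_ R
          (powR R (CommutativeRing.-_ R (CommutativeRing.1# R)) (n ∸ 1))
          (powR R (jacobi R F (chiPow R F γ e ζ a) (chiPow R F γ e ζ b)) n)))
   ⇔
   (∀ (i j : Fin e) →
      multMatrix p K γ′ e i j
        ≡ (-[1+ 0 ] ℤ.^ (n ∸ 1)) ℤ.* foldCompose e (multMatrix p F γ e) (n ∸ 1) i j))
theorem1p3 e p r (suc n′) 2≤e prime-p 1≤r e∣q-1 1≤n F K ι emb Nr ι-Nr γ gen R domain ζ ζ-prim γ′ gen′ lift =
  Lift.equivalence R domain e ζ ζ-prim 2≤e p n′ q′≡q^n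
    (λ { ≡.refl → 2^r-odd r 1≤r }) (λ p≢2 → p^r-even prime-p p≢2 r)
    (λ { ≡.refl → 2^r-odd (suc n′ * r) (ℕₚ.*-mono-≤ 1≤n 1≤r) }) (λ p≢2 → p^r-even prime-p p≢2 (suc n′ * r))
    F K ι emb Nr ι-Nr gen e∣q-1 gen′ e∣q′-1 lift
  where
  q′≡q^n : p ^ (suc n′ * r) ≡ (p ^ r) ^ suc n′
  q′≡q^n = ≡.trans (≡.cong (p ^_) (ℕₚ.*-comm (suc n′) r)) (≡.sym (ℕₚ.^-*-assoc p r (suc n′)))
  1≤q : 1 ≤ p ^ r
  1≤q = ℕₚ.≤-trans (Generator.1≤q-1 F gen) (ℕₚ.m∸n≤m (p ^ r) 1)
  e∣q′-1 : e ∣ p ^ (suc n′ * r) ∸ 1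
  e∣q′-1 = ∣-trans e∣q-1 (≡.subst (λ q′ → (p ^ r ∸ 1) ∣ (q′ ∸ 1)) (≡.sym q′≡q^n) (q-1∣q^n-1 (p ^ r) (suc n′) 1≤q))
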